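{- Let $A$ be a type of $\mathsf{\Lambda2}$. If the tree $\mathsf t(A)$ is coherent, then there exists a $\mathsf{\Lambda p}_{\mu\nu}$-type $A'$ such that $A\equiv_{\mathsf Y}A'$.
   Context: **Types.** Types are given by $A,B::=X\mid A\Rightarrow B\mid\forall X.A\mid 0\mid 1\mid A+B\mid A\times B\mid \mu X.A\mid\nu X.A$, where $\mu X.A,\nu X.A$ are allowed only when all occurrences of $X$ in $A$ are positive; types are taken up to renaming of bound variables. A $\mathsf{\Lambda2}$-type uses only variables, $\Rightarrow,\forall$; a $\mathsf{\Lambda p}_{\mu\nu}$-type contains no $\forall$. An occurrence of a variable is positive if it lies to the left of an even number of arrows, negative otherwise. $\langle C_i\rangle_i\Rightarrow B$ denotes $C_1\Rightarrow\dots\Rightarrow C_k\Rightarrow B$ ($B$ if the list is empty). Empty sums and products are $0$ and $1$. $\exists\vec Y.A$ is shorthand for $\forall Y'.(\forall\vec Y.(A\Rightarrow Y'))\Rightarrow Y'$ with $Y'$ fresh ($A$ if $\vec Y$ is empty). Substitutions are capture-avoiding. **The relation $\equiv_{\mathsf Y}$.** Smallest congruence on types (equivalence relation compatible with all type constructors) containing: (Y+) $\forall X.\forall\vec Y.\big\langle\forall\vec Z_k.\langle A_{jk}\rangle_{j\in J_k}\Rightarrow X\big\rangle_{k\in K}\Rightarrow B\ \equiv\ \forall\vec Y.B\big[\{\mu X.\}\sum_{k}\exists\vec Z_k.\prod_{j}A_{jk}/X\big]$, if $X$ has only positive occurrences in each $A_{jk}$ and in $B$; (Y−) $\forall X.\forall\vec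 Y.\big\langle\forall\vec Z_k.X\Rightarrow A_k\big\rangle_{k\in K}\Rightarrow B\ \equiv\ \forall\vec Y.B\big[\{\nu X.\}\prod_k\forall\vec Z_k.A_k/X\big]$, if $X$ has only positive occurrences in each $A_k$ and only negative occurrences in $B$; ($\{\mu X.\}$, $\{\nu X.\}$: the binder is written only if $X$ occurs in some $A_{jk}$, resp. $A_k$); together with: $A\Rightarrow(B\Rightarrow C)\equiv B\Rightarrow(A\Rightarrow C)$; $\forall X.\forall Y.A\equiv\forall Y.\forall X.A$; $A\equiv\forall X.A$ and $A\Rightarrow\forall X.B\equiv\forall X.(A\Rightarrow B)$ for $X$ not free in $A$; $A\times1\equiv A$; $1\Rightarrow A\equiv A$; associativity and commutativity of $\times$; $(A\times B)\Rightarrow C\equiv A\Rightarrow(B\Rightarrow C)$; $A\Rightarrow(B\times C)\equiv(A\Rightarrow B)\times(A\Rightarrow C)$; $\forall X.(A\times B)\equiv\forall X.A\times\forall X.B$; $A+0\equiv A$; $A\times0\equiv0$; $0\Rightarrow A\equiv1$; associativity and commutativity of $+$; $A\times(B+C)\equiv(A\times B)+(A\times C)$; $(A+B)\Rightarrow C\equiv(A\Rightarrow C)\times(B\Rightarrow C)$; $\mu X.A\equiv\nu X.A\equiv A$ for $X$ not free in $A$; $\mu X.A\equiv A[\mu X.A/X]$; $\nu X.A\equiv A[\nu X.A/X]$. **Trees.** Every $\mathsf{\Lambda2}$-type can be put in normal form $\forall\vec Y.A_1\Rightarrow\dots\Rightarrow A_n\Rightarrow X$, with each variable of $\vec Y$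 occurring in $A_1\Rightarrow\dots\Rightarrow A_n\Rightarrow X$ and the $A_i$ in normal form, by deleting vacuous quantifiers and using $A\Rightarrow\forall X.B\equiv\forall X.(A\Rightarrow B)$; this is unique up to order of quantifiers and arguments. Colors are $c\in\{\mathrm{blue},\mathrm{red}\}$, $\overline c$ is the other color, and $X^c$ is the variable $X$ with color $c$. For a type $A$ with normal form $\forall\vec Y.A_1\Rightarrow\dots\Rightarrow A_n\Rightarrow X$, $\mathsf t^c(A)$ is the rooted tree with root labelled by the set $\vec Y$, whose immediate successors are the roots of $\mathsf t^{\overline c}(A_1),\dots,\mathsf t^{\overline c}(A_n)$ and a terminal node labelled $X^c$, called the *head* of the tree. When an argument $A_i$ is just a variable $Z$, its tree is drawn as a single terminal node labelled $Z^{\overline c}$, except that if $Z$ is quantified at that same root ($Z\in\vec Y$) it is kept in the expanded form: a node labelled $\emptyset$ whose only successor is the terminal node $Z^{\overline c}$. Put $\mathsf t(A)=\mathsf t^{\mathrm{blue}}(A)$. Bound variables are assumed pairwise distinct; for a bound variable $X$, $\mathsf r_X$ is the unique node whose label contains $X$ and $\mathsf h_X$ is the head of the subtree rooted at $\mathsf r_X$. **Coherence.** Two distinct nodes are *parallel* if they are immediate successors of the same node; $d(\alpha,\beta)$ is the number of edges of the path from $\alpha$ to $\beta$. For a bound variable $X$, a terminal node $\alpha$ labelled $X^c$ is *modular* if $\alpha\ne\mathsf h_X$, $1\le d(\alpha,\mathsf r_X)\le2$, and $\alpha$ has no parallel node labelled $X^c$. $X$ is *$c$-eliminable* if every node labelled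 $X^{\overline c}$ is modular. For bound variables $X,Y$ and colors $c,d$, $X^c$ and $Y^d$ are *coherent* if there are no parallel modular nodes $\alpha$ labelled $X^{\overline c}$ and $\beta$ labelled $Y^{\overline d}$. A tree is *coherent* if there is a map $\phi$ from its bound variables to colors such that every bound variable $X$ is $\phi(X)$-eliminable and, for all distinct bound variables $X,Y$, $X^{\phi(X)}$ and $Y^{\phi(Y)}$ are coherent. -}

module Defs where

open import Data.Empty using (⊥)
open import Data.Fin using (Fin; zero; suc; _↑ˡ_; _↑ʳ_; splitAt)
open import Data.Fin.Properties using (_≟_)
open import Data.List using (List; []; _∷_; foldr; map; length; lookup)
open import Data.List.Relation.Unary.All using (All)
open import Data.Maybe using (Maybe; just; nothing; maybe′; zipWith) renaming (map to mapMaybe)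
open import Data.Nat using (ℕ; zero; suc; _+_; _≤_)
open import Data.Product using (Σ-syntax; ∃-syntax; _×_; _,_)
open import Data.Sign using (Sign; opposite) renaming (+ to pos; - to neg)
open import Data.Sum using (inj₁; inj₂)
open import Data.Unit using (⊤)
open import Function using (id; _∘_)
open import Relation.Binary.PropositionalEquality using (_≡_; _≢_; refl)
open import Relation.Nullary using (¬_; yes; no)

private variable
  m n : ℕ

------------------------------------------------------------------------
-- Types

infixr 20 _⇒_
infixr 21 _⊕_
infixr 22 _⊗_
infix  23 ∀̇_ μ̇_ ν̇_

-- Pretypes with free variables in Fin n, in de Bruijn notation (so up to
-- renaming of bound variables).  The positivity restriction on μ and ν is
-- the predicate Wf below; the types proper are the pretypes satisfying Wf.
data Ty (n : ℕ) : Set where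
  var     : Fin n → Ty n
  _⇒_     : Ty n → Ty n → Ty n
  ∀̇_      : Ty (suc n) → Ty n
  𝟘 𝟙     : Ty n
  _⊕_ _⊗_ : Ty n → Ty n → Ty n
  μ̇_ ν̇_   : Ty (suc n) → Ty n

-- Only s x A: every occurrence of x in A has sign s.
Only : Sign → Fin n → Ty n → Set
Only s x (var y) = x ≡ y → s ≡ pos
Only s x (A ⇒ B) = Only (opposite s) x A × Only s x B
Only s x (∀̇ A)   = Only s (suc x) A
Only s x 𝟘       = ⊤
Only s x 𝟙       = ⊤
Only s x (A ⊕ B) = Only s x A × Only s x B
Only s x (A ⊗ B) = Only s x A × Only s x B
Only s x (μ̇ A)   = Only s (suc x) A
Only s x (ν̇ A)   = Only s (suc x) A

Wf : Ty n → Set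
Wf (var x) = ⊤
Wf (A ⇒ B) = Wf A × Wf B
Wf (∀̇ A)   = Wf A
Wf 𝟘       = ⊤
Wf 𝟙       = ⊤
Wf (A ⊕ B) = Wf A × Wf B
Wf (A ⊗ B) = Wf A × Wf B
Wf (μ̇ A)   = Only pos zero A × Wf A
Wf (ν̇ A)   = Only pos zero A × Wf A

data Λ2 : Ty n → Set where
  var : (x : Fin n) → Λ2 (var x)
  _⇒_ : {A B : Ty n} → Λ2 A → Λ2 B → Λ2 (A ⇒ B)
  ∀̇_  : {A : Ty (suc n)} → Λ2 A → Λ2 (∀̇ A)

∀-free : Ty n → Set
∀-free (var x) = ⊤
∀-free (A ⇒ B) = ∀-free A × ∀-free B
∀-free (∀̇ A)   = ⊥
∀-free 𝟘       = ⊤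
∀-free 𝟙       = ⊤
∀-free (A ⊕ B) = ∀-free A × ∀-free B
∀-free (A ⊗ B) = ∀-free A × ∀-free B
∀-free (μ̇ A)   = ∀-free A
∀-free (ν̇ A)   = ∀-free A

Λpμν : Ty n → Set
Λpμν A = Wf A × ∀-free A

------------------------------------------------------------------------
-- Renaming and substitution

lift : (Fin m → Fin n) → Fin (suc m) → Fin (suc n)
lift ρ zero    = zero
lift ρ (suc x) = suc (ρ x)

lift* : ∀ k → (Fin m → Fin n) → Fin (k + m) → Fin (k + n)
lift* zero    ρ = ρ
lift* (suc k) ρ = lift (lift* k ρ)

rename : (Fin m → Fin n) → Ty m → Ty n
rename ρ (var x) = var (ρ x)
rename ρ (A ⇒ B) = rename ρ A ⇒ rename ρ B
rename ρ (∀̇ A)   = ∀̇ rename (lift ρ) A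
rename ρ 𝟘       = 𝟘
rename ρ 𝟙       = 𝟙
rename ρ (A ⊕ B) = rename ρ A ⊕ rename ρ B
rename ρ (A ⊗ B) = rename ρ A ⊗ rename ρ B
rename ρ (μ̇ A)   = μ̇ rename (lift ρ) A
rename ρ (ν̇ A)   = ν̇ rename (lift ρ) A

wk : Ty n → Ty (suc n)
wk = rename suc

liftₛ : (Fin m → Ty n) → Fin (suc m) → Ty (suc n)
liftₛ σ zero    = var zero
liftₛ σ (suc x) = wk (σ x)

subst : (Fin m → Ty n) → Ty m → Ty n
subst σ (var x) = σ x
subst σ (A ⇒ B) = subst σ A ⇒ subst σ B
subst σ (∀̇ A)   = ∀̇ subst (liftₛ σ) A
subst σ 𝟘       = 𝟘
subst σ 𝟙       = 𝟙
subst σ (A ⊕ B) = subst σ A ⊕ subst σ B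
subst σ (A ⊗ B) = subst σ A ⊗ subst σ B
subst σ (μ̇ A)   = μ̇ subst (liftₛ σ) A
subst σ (ν̇ A)   = ν̇ subst (liftₛ σ) A

infix 24 _[_]

_[_] : Ty (suc n) → Ty n → Ty n
A [ B ] = subst (λ { zero → B ; (suc x) → var x }) A

-- Partial renamings are used to remove a variable that does not occur:
-- strengthen A is just A′ if A is wk A′, and nothing if zero occurs in A.

lift? : (Fin m → Maybe (Fin n)) → Fin (suc m) → Maybe (Fin (suc n))
lift? ρ zero    = just zero
lift? ρ (suc x) = mapMaybe suc (ρ x)

rename? : (Fin m → Maybe (Fin n)) → Ty m → Maybe (Ty n)
rename? ρ (var x) = mapMaybe var (ρ x)
rename? ρ (A ⇒ B) = zipWith _⇒_ (rename? ρ A) (rename? ρ B)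
rename? ρ (∀̇ A)   = mapMaybe ∀̇_ (rename? (lift? ρ) A)
rename? ρ 𝟘       = just 𝟘
rename? ρ 𝟙       = just 𝟙
rename? ρ (A ⊕ B) = zipWith _⊕_ (rename? ρ A) (rename? ρ B)
rename? ρ (A ⊗ B) = zipWith _⊗_ (rename? ρ A) (rename? ρ B)
rename? ρ (μ̇ A)   = mapMaybe μ̇_ (rename? (lift? ρ) A)
rename? ρ (ν̇ A)   = mapMaybe ν̇_ (rename? (lift? ρ) A)

drop-zero : Fin (suc n) → Maybe (Fin n)
drop-zero zero    = nothing
drop-zero (suc x) = just x

strengthen : Ty (suc n) → Maybe (Ty n)
strengthen = rename? drop-zero

-- {μX.}A and {νX.}A: the binder is omitted when X does not occur in A.
μ? ν? : Ty (suc n) → Ty n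
μ? A = maybe′ id (μ̇ A) (strengthen A)
ν? A = maybe′ id (ν̇ A) (strengthen A)

------------------------------------------------------------------------
-- Iterated constructors

infixr 19 _⇒*_

_⇒*_ : List (Ty n) → Ty n → Ty n
Cs ⇒* B = foldr _⇒_ B Cs

∑ ∏ : List (Ty n) → Ty n
∑ []               = 𝟘
∑ (A ∷ [])         = A
∑ (A ∷ As@(_ ∷ _)) = A ⊕ ∑ As
∏ []               = 𝟙
∏ (A ∷ [])         = A
∏ (A ∷ As@(_ ∷ _)) = A ⊗ ∏ As

∀^ : ∀ k → Ty (k + n) → Ty n
∀^ zero    A = A
∀^ (suc k) A = ∀^ k (∀̇ A)

-- The variable Y′ of the encoding is bound outside the k existential ones.
∃^ : ∀ k → Ty (k + n) → Ty n
∃^ zero        A = A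
∃^ k@(suc _) A = ∀̇ (∀^ k (rename (lift* k suc) A ⇒ var (k ↑ʳ zero)) ⇒ var zero)

------------------------------------------------------------------------
-- The relation ≡Y

swap : Fin (suc (suc n)) → Fin (suc (suc n))
swap zero          = suc zero
swap (suc zero)    = zero
swap (suc (suc x)) = suc (suc x)

-- Turns the scope X, Y₁, …, Yₘ (Yₘ innermost) into Y₁, …, Yₘ, X.
to-front : ∀ m → Fin (m + suc n) → Fin (suc (m + n))
to-front zero    x = x
to-front (suc m) x = swap (lift (to-front m) x)

-- (z , ⟨A_j⟩_j) stands for ∀Z₁…Z_z.⟨A_j⟩_j ⇒ X, and (z , A) for
-- ∀Z₁…Z_z.X ⇒ A, for the variable X given as first argument of hyp.

Clause⁺ Clause⁻ : ℕ → Set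
Clause⁺ n = Σ[ z ∈ ℕ ] List (Ty (z + n))
Clause⁻ n = Σ[ z ∈ ℕ ] Ty (z + n)

hyp⁺ : Fin n → Clause⁺ n → Ty n
hyp⁺ X (z , As) = ∀^ z (As ⇒* var (z ↑ʳ X))

hyp⁻ : Fin n → Clause⁻ n → Ty n
hyp⁻ X (z , A) = ∀^ z (var (z ↑ʳ X) ⇒ A)

sol⁺ : List (Clause⁺ n) → Ty n
sol⁺ Cs = ∑ (map (λ (z , As) → ∃^ z (∏ As)) Cs)

sol⁻ : List (Clause⁻ n) → Ty n
sol⁻ Cs = ∏ (map (λ (z , A) → ∀^ z A) Cs)

data Axiom {n : ℕ} : Ty n → Ty n → Set where
  Y⁺ : ∀ m (Cs : List (Clause⁺ (m + suc n))) (B : Ty (m + suc n)) →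
       let X = m ↑ʳ zero in
       All (λ (z , As) → All (Only pos (z ↑ʳ X)) As) Cs →
       Only pos X B →
       Axiom (∀̇ ∀^ m (map (hyp⁺ X) Cs ⇒* B))
             (∀^ m (rename (to-front m) B [ μ? (rename (to-front m) (sol⁺ Cs)) ]))
  Y⁻ : ∀ m (Cs : List (Clause⁻ (m + suc n))) (B : Ty (m + suc n)) →
       let X = m ↑ʳ zero in
       All (λ (z , A) → Only pos (z ↑ʳ X) A) Cs →
       Only neg X B →
       Axiom (∀̇ ∀^ m (map (hyp⁻ X) Cs ⇒* B))
             (∀^ m (rename (to-front m) B [ ν? (rename (to-front m) (sol⁻ Cs)) ]))

  ⇒-swap  : ∀ A B C → Axiom (A ⇒ (B ⇒ C)) (B ⇒ (A ⇒ C))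
  ∀-swap  : ∀ A → Axiom (∀̇ ∀̇ A) (∀̇ ∀̇ rename swap A)
  ∀-vac   : ∀ A → Axiom A (∀̇ wk A)
  ⇒-∀     : ∀ A B → Axiom (A ⇒ ∀̇ B) (∀̇ (wk A ⇒ B))

  ⊗-unit  : ∀ A → Axiom (A ⊗ 𝟙) A
  𝟙-⇒     : ∀ A → Axiom (𝟙 ⇒ A) A
  ⊗-assoc : ∀ A B C → Axiom ((A ⊗ B) ⊗ C) (A ⊗ (B ⊗ C))
  ⊗-comm  : ∀ A B → Axiom (A ⊗ B) (B ⊗ A)
  ⊗-⇒     : ∀ A B C → Axiom ((A ⊗ B) ⇒ C) (A ⇒ (B ⇒ C))
  ⇒-⊗     : ∀ A B C → Axiom (A ⇒ (B ⊗ C)) ((A ⇒ B) ⊗ (A ⇒ C))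
  ∀-⊗     : ∀ A B → Axiom (∀̇ (A ⊗ B)) (∀̇ A ⊗ ∀̇ B)

  ⊕-unit  : ∀ A → Axiom (A ⊕ 𝟘) A
  ⊗-𝟘     : ∀ A → Axiom (A ⊗ 𝟘) 𝟘
  𝟘-⇒     : ∀ A → Axiom (𝟘 ⇒ A) 𝟙
  ⊕-assoc : ∀ A B C → Axiom ((A ⊕ B) ⊕ C) (A ⊕ (B ⊕ C))
  ⊕-comm  : ∀ A B → Axiom (A ⊕ B) (B ⊕ A)
  ⊗-⊕     : ∀ A B C → Axiom (A ⊗ (B ⊕ C)) ((A ⊗ B) ⊕ (A ⊗ C))
  ⊕-⇒     : ∀ A B C → Axiom ((A ⊕ B) ⇒ C) ((A ⇒ C) ⊗ (B ⇒ C))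

  μ-vac   : ∀ A → Axiom (μ̇ wk A) A
  ν-vac   : ∀ A → Axiom (ν̇ wk A) A
  μ-fix   : ∀ A → Axiom (μ̇ A) (A [ μ̇ A ])
  ν-fix   : ∀ A → Axiom (ν̇ A) (A [ ν̇ A ])

infix 4 _≡Y_

-- The premises on axiom, refl, μ-cong and ν-cong ensure that only types
-- satisfying Wf are related, so this is a congruence on types proper.
data _≡Y_ {n : ℕ} : Ty n → Ty n → Set where
  axiom  : ∀ {A B} → Wf A → Wf B → Axiom A B → A ≡Y B
  refl   : ∀ {A} → Wf A → A ≡Y A
  sym    : ∀ {A B} → A ≡Y B → B ≡Y A
  trans  : ∀ {A B C} → A ≡Y B → B ≡Y C → A ≡Y C
  ⇒-cong : ∀ {A A′ B B′} → A ≡Y A′ → B ≡Y B′ → A ⇒ B ≡Y A′ ⇒ B′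
  ∀-cong : ∀ {A A′} → A ≡Y A′ → ∀̇ A ≡Y ∀̇ A′
  ⊕-cong : ∀ {A A′ B B′} → A ≡Y A′ → B ≡Y B′ → A ⊕ B ≡Y A′ ⊕ B′
  ⊗-cong : ∀ {A A′ B B′} → A ≡Y A′ → B ≡Y B′ → A ⊗ B ≡Y A′ ⊗ B′
  μ-cong : ∀ {A A′} → Only pos zero A → Only pos zero A′ → A ≡Y A′ → μ̇ A ≡Y μ̇ A′
  ν-cong : ∀ {A A′} → Only pos zero A → Only pos zero A′ → A ≡Y A′ → ν̇ A ≡Y ν̇ A′

------------------------------------------------------------------------
-- Normal forms of Λ2-types

-- ∀Y₁…∀Yₘ.A₁ ⇒ … ⇒ Aₖ ⇒ X, where Ne is the part below the quantifiers.
mutual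
  data Nf (n : ℕ) : Set where
    ∀̇_  : Nf (suc n) → Nf n
    ⌊_⌋ : Ne n → Nf n

  data Ne (n : ℕ) : Set where
    var : Fin n → Ne n
    _⇒_ : Nf n → Ne n → Ne n

mutual
  renameNf : (Fin m → Fin n) → Nf m → Nf n
  renameNf ρ (∀̇ A) = ∀̇ renameNf (lift ρ) A
  renameNf ρ ⌊ A ⌋ = ⌊ renameNe ρ A ⌋

  renameNe : (Fin m → Fin n) → Ne m → Ne n
  renameNe ρ (var x) = var (ρ x)
  renameNe ρ (A ⇒ B) = renameNf ρ A ⇒ renameNe ρ B

mutual
  renameNf? : (Fin m → Maybe (Fin n)) → Nf m → Maybe (Nf n)
  renameNf? ρ (∀̇ A) = mapMaybe ∀̇_ (renameNf? (lift? ρ) A)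
  renameNf? ρ ⌊ A ⌋ = mapMaybe ⌊_⌋ (renameNe? ρ A)

  renameNe? : (Fin m → Maybe (Fin n)) → Ne m → Maybe (Ne n)
  renameNe? ρ (var x) = mapMaybe var (ρ x)
  renameNe? ρ (A ⇒ B) = zipWith _⇒_ (renameNf? ρ A) (renameNe? ρ B)

-- Quantifies over zero, unless it does not occur.
quantify : Nf (suc n) → Nf n
quantify A = maybe′ id (∀̇ A) (renameNf? drop-zero A)

-- The normal form of A ⇒ B, using A ⇒ ∀X.B ≡ ∀X.(A ⇒ B).
_⇒ₙ_ : Nf n → Nf n → Nf n
A ⇒ₙ (∀̇ B) = ∀̇ (renameNf suc A ⇒ₙ B)
A ⇒ₙ ⌊ B ⌋ = ⌊ A ⇒ B ⌋

nf : {A : Ty n} → Λ2 A → Nf n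
nf (var x) = ⌊ var x ⌋
nf (A ⇒ B) = nf A ⇒ₙ nf B
nf (∀̇ A)   = quantify (nf A)

------------------------------------------------------------------------
-- Trees

data Color : Set where
  blue red : Color

other : Color → Color
other blue = red
other red  = blue

-- node m h ts is labelled by m variables, bound in the subtrees; its
-- immediate successors are the roots of h ∷ ts.  Successors are unordered in
-- the mathematics: here the first one, h, is the head.
data Tree (n : ℕ) : Set where
  terminal : Fin n → Color → Tree n
  node     : (m : ℕ) → Tree (m + n) → List (Tree (m + n)) → Tree n

-- In the following, m is the number of quantifiers read so far at the current
-- root, and c the color of that root.
mutual
  treeNf : ∀ m → Color → Nf (m + n) → Tree n
  treeNf m c (∀̇ A) = treeNf (suc m) c A
  treeNf m c ⌊ A ⌋ = node m (headTree c A) (argTrees m c A)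

  headTree : Color → Ne n → Tree n
  headTree c (var x) = terminal x c
  headTree c (A ⇒ B) = headTree c B

  argTrees : ∀ m → Color → Ne (m + n) → List (Tree (m + n))
  argTrees m c (var x) = []
  argTrees m c (A ⇒ B) = argTree m c A ∷ argTrees m c B

  -- An argument that is just a variable is a terminal node, unless the variable
  -- is quantified at the current root (inj₁).
  argTree : ∀ m → Color → Nf (m + n) → Tree (m + n)
  argTree m c ⌊ var z ⌋ with splitAt m z
  ... | inj₁ _ = node 0 (terminal z (other c)) []
  ... | inj₂ _ = terminal z (other c)
  argTree m c A@(⌊ _ ⇒ _ ⌋) = treeNf 0 (other c) A
  argTree m c A@(∀̇ _)       = treeNf 0 (other c) A

tree : {A : Ty n} → Λ2 A → Tree n
tree A = treeNf 0 blue (nf A)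

data Node : Tree n → Set where
  root  : {t : Tree n} → Node t
  child : {h : Tree (m + n)} {ts : List (Tree (m + n))}
          (i : Fin (suc (length ts))) → Node (lookup (h ∷ ts) i) → Node {n} (node m h ts)

-- An element of BVar t is a binding occurrence, so bound variables are
-- automatically pairwise distinct.
data BVar : Tree n → Set where
  here  : {h : Tree (m + n)} {ts : List (Tree (m + n))} →
          Fin m → BVar {n} (node m h ts)
  there : {h : Tree (m + n)} {ts : List (Tree (m + n))}
          (i : Fin (suc (length ts))) → BVar (lookup (h ∷ ts) i) → BVar {n} (node m h ts)

private variable
  t : Tree n

-- r X is the node whose label contains X, and h X the head of its subtree.
r h : BVar t → Node t
r (here x)    = root
r (there i X) = child i (r X)
h (here x)    = child zero root
h (there i X) = child i (h X)

-- Terminal nodes labelled by a free variable of the tree …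
data IsFree : {t : Tree n} → Node t → Fin n → Color → Set where
  terminal : {x : Fin n} {c : Color} → IsFree {t = terminal x c} root x c
  child    : {h : Tree (m + n)} {ts : List (Tree (m + n))}
             {i : Fin (suc (length ts))} {α : Node (lookup (h ∷ ts) i)}
             {x : Fin n} {c : Color} →
             IsFree α (m ↑ʳ x) c → IsFree {t = node m h ts} (child i α) x c

-- … and those labelled X^c for a bound variable X.
data _labelled_^_ : {t : Tree n} → Node t → BVar t → Color → Set where
  here  : {h : Tree (m + n)} {ts : List (Tree (m + n))}
          {i : Fin (suc (length ts))} {α : Node (lookup (h ∷ ts) i)}
          {x : Fin m} {c : Color} →
          IsFree α (x ↑ˡ n) c → _labelled_^_ {t = node m h ts} (child i α) (here x) c
  there : {h : Tree (m + n)} {ts : List (Tree (m + n))}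
          {i : Fin (suc (length ts))} {α : Node (lookup (h ∷ ts) i)}
          {X : BVar (lookup (h ∷ ts) i)} {c : Color} →
          α labelled X ^ c → _labelled_^_ {t = node m h ts} (child i α) (there i X) c

depth : Node t → ℕ
depth root        = 0
depth (child i α) = suc (depth α)

d : Node t → Node t → ℕ
d root        β           = depth β
d (child i α) root        = suc (depth α)
d (child i α) (child j β) with i ≟ j
... | yes refl = d α β
... | no  _    = suc (depth α) + suc (depth β)

-- γ ⋖ α: α is an immediate successor of γ.
data _⋖_ : {t : Tree n} → Node t → Node t → Set where
  here  : {h : Tree (m + n)} {ts : List (Tree (m + n))} {i : Fin (suc (length ts))} →
          _⋖_ {t = node m h ts} root (child i root)
  there : {h : Tree (m + n)} {ts : List (Tree (m + n))}
          {i : Fin (suc (length ts))} {γ α : Node (lookup (h ∷ ts) i)} →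
          γ ⋖ α → _⋖_ {t = node m h ts} (child i γ) (child i α)

Parallel : Node t → Node t → Set
Parallel α β = α ≢ β × ∃[ γ ] (γ ⋖ α × γ ⋖ β)

------------------------------------------------------------------------
-- Coherence

-- α is a modular node labelled X^c.
record Modular {t : Tree n} (α : Node t) (X : BVar t) (c : Color) : Set where
  field
    label     : α labelled X ^ c
    not-head  : α ≢ h X
    distance₁ : 1 ≤ d α (r X)
    distance₂ : d α (r X) ≤ 2
    isolated  : ∀ β → Parallel α β → ¬ (β labelled X ^ c)

Eliminable : BVar t → Color → Set
Eliminable X c = ∀ α → α labelled X ^ other c → Modular α X (other c)

CoherentVars : BVar t → Color → BVar t → Color → Set
CoherentVars X c Y c′ =
  ∀ α β → Parallel α β → Modular α X (other c) → ¬ Modular β Y (other c′)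

Coherent : Tree n → Set
Coherent t = Σ[ φ ∈ (BVar t → Color) ]
               ((∀ X → Eliminable X (φ X)) ×
                (∀ X Y → X ≢ Y → CoherentVars X (φ X) Y (φ Y)))

module Submission where

-- Coherence is a local condition.  An occurrence of a bound variable with the
-- color opposite to the chosen one is modular, hence two edges below the node
-- binding the variable: it is the head of an argument of that node (for Y⁺), or
-- an argument of such an argument (for Y⁻); and an argument contains at most one
-- such occurrence, over all the variables bound at that node.  So, if the
-- quantifiers inside the arguments are eliminated first, every argument of
-- ∀X₁…Xₘ.A₁ ⇒ … ⇒ Aₖ ⇒ Y is equivalent to a ∀-free type which is a clause As ⇒ Xᵢ
-- of Y⁺, a clause Xᵢ ⇒ A of Y⁻, or a type in which each Xᵢ has only the right
-- sign.  The Xᵢ are then eliminated one after another.  The solution for Xᵢ is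
-- substituted only at occurrences of the right sign, so all signs are preserved
-- and the clauses of the remaining variables are still clauses.

open import Data.Fin using (Fin; zero; suc; _↑ˡ_; _↑ʳ_; splitAt)
open import Data.Fin.Properties using (_≟_; any?; splitAt-↑ʳ; suc-injective)
open import Data.List using (List; []; _∷_; map; length; lookup)
open import Data.List.Properties using (map-∘; tabulate-lookup)
open import Data.List.Relation.Unary.All as All using (All; []; _∷_)
open import Data.List.Relation.Unary.All.Properties using (map⁺; tabulate⁺)
open import Data.List.Relation.Unary.AllPairs using (AllPairs; []; _∷_)
import Data.List.Relation.Unary.AllPairs.Properties as AllPairs
open import Data.Maybe using (Maybe; just; nothing)
open import Data.Nat using (ℕ; zero; suc; _+_; _≤_; s≤s⁻¹)
open import Data.Product using (Σ-syntax; ∃-syntax; _×_; _,_; proj₁; proj₂)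
open import Data.Sign using (Sign; opposite; _*_) renaming (+ to pos; - to neg)
open import Data.Sign.Properties as Sign using (opposite-involutive; s*s≡+)
open import Data.Sum using (_⊎_; inj₁; inj₂)
open import Data.Unit using (⊤; tt)
open import Function using (Injective; _∘_)
open import Relation.Binary.PropositionalEquality as ≡ using (_≡_; _≢_; refl; cong; cong₂)
open import Relation.Nullary using (¬_; Dec; yes; no; contradiction; _×-dec_)

open import Defs

private variable
  m n : ℕ
  s : Sign
  t : Tree n

-- Signs under renaming and substitution

lift-injective : {ρ : Fin m → Fin n} → Injective _≡_ _≡_ ρ → Injective _≡_ _≡_ (lift ρ)
lift-injective inj {zero}  {zero}  eq = refl
lift-injective inj {suc x} {suc y} eq = cong suc (inj (suc-injective eq))

lift-≢ : {ρ : Fin m → Fin n} {y : Fin n} → (∀ x → ρ x ≢ y) → ∀ x → lift ρ x ≢ suc y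
lift-≢ ρ≢y (suc x) eq = ρ≢y x (suc-injective eq)

Only-rename : {ρ : Fin m → Fin n} → Injective _≡_ _≡_ ρ →
              ∀ {x} A → Only s x A → Only s (ρ x) (rename ρ A)
Only-rename inj (var y) o eq      = o (inj eq)
Only-rename inj (A ⇒ B) (o₁ , o₂) = Only-rename inj A o₁ , Only-rename inj B o₂
Only-rename inj (∀̇ A)   o         = Only-rename (lift-injective inj) A o
Only-rename inj 𝟘       o         = tt
Only-rename inj 𝟙       o         = tt
Only-rename inj (A ⊕ B) (o₁ , o₂) = Only-rename inj A o₁ , Only-rename inj B o₂
Only-rename inj (A ⊗ B) (o₁ , o₂) = Only-rename inj A o₁ , Only-rename inj B o₂
Only-rename inj (μ̇ A)   o         = Only-rename (lift-injective inj) A o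
Only-rename inj (ν̇ A)   o         = Only-rename (lift-injective inj) A o

Only-rename⁻ : {ρ : Fin m → Fin n} → ∀ {x} A → Only s (ρ x) (rename ρ A) → Only s x A
Only-rename⁻ (var y) o eq      = o (cong _ eq)
Only-rename⁻ (A ⇒ B) (o₁ , o₂) = Only-rename⁻ A o₁ , Only-rename⁻ B o₂
Only-rename⁻ (∀̇ A)   o         = Only-rename⁻ A o
Only-rename⁻ 𝟘       o         = tt
Only-rename⁻ 𝟙       o         = tt
Only-rename⁻ (A ⊕ B) (o₁ , o₂) = Only-rename⁻ A o₁ , Only-rename⁻ B o₂
Only-rename⁻ (A ⊗ B) (o₁ , o₂) = Only-rename⁻ A o₁ , Only-rename⁻ B o₂
Only-rename⁻ (μ̇ A)   o         = Only-rename⁻ A o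
Only-rename⁻ (ν̇ A)   o         = Only-rename⁻ A o

Only-fresh : {ρ : Fin m → Fin n} {y : Fin n} → (∀ x → ρ x ≢ y) →
             ∀ A → Only s y (rename ρ A)
Only-fresh ρ≢y (var x) eq = contradiction (≡.sym eq) (ρ≢y x)
Only-fresh ρ≢y (A ⇒ B)    = Only-fresh ρ≢y A , Only-fresh ρ≢y B
Only-fresh ρ≢y (∀̇ A)      = Only-fresh (lift-≢ ρ≢y) A
Only-fresh ρ≢y 𝟘          = tt
Only-fresh ρ≢y 𝟙          = tt
Only-fresh ρ≢y (A ⊕ B)    = Only-fresh ρ≢y A , Only-fresh ρ≢y B
Only-fresh ρ≢y (A ⊗ B)    = Only-fresh ρ≢y A , Only-fresh ρ≢y B
Only-fresh ρ≢y (μ̇ A)      = Only-fresh (lift-≢ ρ≢y) A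
Only-fresh ρ≢y (ν̇ A)      = Only-fresh (lift-≢ ρ≢y) A

Wf-rename : {ρ : Fin m → Fin n} → Injective _≡_ _≡_ ρ → ∀ A → Wf A → Wf (rename ρ A)
Wf-rename inj (var x) w         = tt
Wf-rename inj (A ⇒ B) (w₁ , w₂) = Wf-rename inj A w₁ , Wf-rename inj B w₂
Wf-rename inj (∀̇ A)   w         = Wf-rename (lift-injective inj) A w
Wf-rename inj 𝟘       w         = tt
Wf-rename inj 𝟙       w         = tt
Wf-rename inj (A ⊕ B) (w₁ , w₂) = Wf-rename inj A w₁ , Wf-rename inj B w₂
Wf-rename inj (A ⊗ B) (w₁ , w₂) = Wf-rename inj A w₁ , Wf-rename inj B w₂
Wf-rename inj (μ̇ A)   (o , w)   =
  Only-rename (lift-injective inj) A o , Wf-rename (lift-injective inj) A w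
Wf-rename inj (ν̇ A)   (o , w)   =
  Only-rename (lift-injective inj) A o , Wf-rename (lift-injective inj) A w

Wf-rename⁻ : {ρ : Fin m → Fin n} → ∀ A → Wf (rename ρ A) → Wf A
Wf-rename⁻ (var x) w         = tt
Wf-rename⁻ (A ⇒ B) (w₁ , w₂) = Wf-rename⁻ A w₁ , Wf-rename⁻ B w₂
Wf-rename⁻ (∀̇ A)   w         = Wf-rename⁻ A w
Wf-rename⁻ 𝟘       w         = tt
Wf-rename⁻ 𝟙       w         = tt
Wf-rename⁻ (A ⊕ B) (w₁ , w₂) = Wf-rename⁻ A w₁ , Wf-rename⁻ B w₂
Wf-rename⁻ (A ⊗ B) (w₁ , w₂) = Wf-rename⁻ A w₁ , Wf-rename⁻ B w₂
Wf-rename⁻ (μ̇ A)   (o , w)   = Only-rename⁻ A o , Wf-rename⁻ A w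
Wf-rename⁻ (ν̇ A)   (o , w)   = Only-rename⁻ A o , Wf-rename⁻ A w

∀-free-rename : {ρ : Fin m → Fin n} → ∀ A → ∀-free A → ∀-free (rename ρ A)
∀-free-rename (var x) f         = tt
∀-free-rename (A ⇒ B) (f₁ , f₂) = ∀-free-rename A f₁ , ∀-free-rename B f₂
∀-free-rename 𝟘       f         = tt
∀-free-rename 𝟙       f         = tt
∀-free-rename (A ⊕ B) (f₁ , f₂) = ∀-free-rename A f₁ , ∀-free-rename B f₂
∀-free-rename (A ⊗ B) (f₁ , f₂) = ∀-free-rename A f₁ , ∀-free-rename B f₂
∀-free-rename (μ̇ A)   f         = ∀-free-rename A f
∀-free-rename (ν̇ A)   f         = ∀-free-rename A f

∀-free-rename⁻ : {ρ : Fin m → Fin n} → ∀ A → ∀-free (rename ρ A) → ∀-free A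
∀-free-rename⁻ (var x) f         = tt
∀-free-rename⁻ (A ⇒ B) (f₁ , f₂) = ∀-free-rename⁻ A f₁ , ∀-free-rename⁻ B f₂
∀-free-rename⁻ 𝟘       f         = tt
∀-free-rename⁻ 𝟙       f         = tt
∀-free-rename⁻ (A ⊕ B) (f₁ , f₂) = ∀-free-rename⁻ A f₁ , ∀-free-rename⁻ B f₂
∀-free-rename⁻ (A ⊗ B) (f₁ , f₂) = ∀-free-rename⁻ A f₁ , ∀-free-rename⁻ B f₂
∀-free-rename⁻ (μ̇ A)   f         = ∀-free-rename⁻ A f
∀-free-rename⁻ (ν̇ A)   f         = ∀-free-rename⁻ A f

-- Either y does not occur in the type substituted for x, or the occurrences of
-- x have a known sign e, and then those of y in that type must have sign e * s.
record OnlyAfter (σ : Fin m → Ty n) (s : Sign) (y : Fin n) (A : Ty m) : Set where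
  constructor after
  field at : ∀ x → (∀ e → Only e y (σ x)) ⊎ (∃[ e ] (Only e x A × Only (e * s) y (σ x)))
open OnlyAfter

opposite-*-opposite : ∀ e s → opposite e * opposite s ≡ e * s
opposite-*-opposite pos s = opposite-involutive s
opposite-*-opposite neg s = refl

-- To the left of an arrow both the sign `e` of the occurrences of `x` and the target sign `s` are
-- reversed, so the product `e * s` does not change.
OnlyAfter-⇒ˡ : {σ : Fin m → Ty n} {y : Fin n} {A B : Ty m} →
               OnlyAfter σ s y (A ⇒ B) → OnlyAfter σ (opposite s) y A
OnlyAfter-⇒ˡ {s = s} {σ} {y} h .at x with h .at x
... | inj₁ fr               = inj₁ fr
... | inj₂ (e , (o , _) , p) =
  inj₂ (opposite e , o , ≡.subst (λ e′ → Only e′ y (σ x)) (≡.sym (opposite-*-opposite e s)) p)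

OnlyAfter-part : {σ : Fin m → Ty n} {y : Fin n} {A B : Ty m} →
                 (∀ {e x} → Only e x A → Only e x B) →
                 OnlyAfter σ s y A → OnlyAfter σ s y B
OnlyAfter-part f h .at x with h .at x
... | inj₁ fr          = inj₁ fr
... | inj₂ (e , o , p) = inj₂ (e , f o , p)

OnlyAfter-lift : {σ : Fin m → Ty n} {y : Fin n} {A : Ty m} {B : Ty (suc m)} →
                 (∀ {e x} → Only e x A → Only e (suc x) B) →
                 OnlyAfter σ s y A → OnlyAfter (liftₛ σ) s (suc y) B
OnlyAfter-lift f h .at zero = inj₁ λ _ ()
OnlyAfter-lift {σ = σ} f h .at (suc x) with h .at x
... | inj₁ fr          = inj₁ λ e → Only-rename suc-injective (σ x) (fr e)
... | inj₂ (e , o , p) = inj₂ (e , f o , Only-rename suc-injective (σ x) p)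

Only-subst : {σ : Fin m → Ty n} {y : Fin n} → ∀ A → OnlyAfter σ s y A → Only s y (subst σ A)
Only-subst (var x) h with h .at x
... | inj₁ fr          = fr _
-- `var x` is itself a positive occurrence of `x`, so `e` is `pos` and `e * s` is `s`.
... | inj₂ (e , o , p) with o refl
...   | refl = p
Only-subst (A ⇒ B) h = Only-subst A (OnlyAfter-⇒ˡ h) , Only-subst B (OnlyAfter-part proj₂ h)
Only-subst (∀̇ A)   h = Only-subst A (OnlyAfter-lift (λ o → o) h)
Only-subst 𝟘       h = tt
Only-subst 𝟙       h = tt
Only-subst (A ⊕ B) h =
  Only-subst A (OnlyAfter-part proj₁ h) , Only-subst B (OnlyAfter-part proj₂ h)
Only-subst (A ⊗ B) h =
  Only-subst A (OnlyAfter-part proj₁ h) , Only-subst B (OnlyAfter-part proj₂ h)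
Only-subst (μ̇ A)   h = Only-subst A (OnlyAfter-lift (λ o → o) h)
Only-subst (ν̇ A)   h = Only-subst A (OnlyAfter-lift (λ o → o) h)

-- The bound variable is mapped to itself and occurs in no other image. Hence the positivity
-- condition of `μ̇` and `ν̇` survives every substitution.
Only-subst-zero : {σ : Fin m → Ty n} → ∀ A → Only s zero A → Only s zero (subst (liftₛ σ) A)
Only-subst-zero {s = s} {σ} A o = Only-subst A λ where
  .at zero    → inj₂ (s , o , λ _ → s*s≡+ s)
  .at (suc x) → inj₁ λ _ → Only-fresh (λ _ ()) (σ x)

Wf-liftₛ : {σ : Fin m → Ty n} → (∀ x → Wf (σ x)) → ∀ x → Wf (liftₛ σ x)
Wf-liftₛ wσ zero    = tt
Wf-liftₛ {σ = σ} wσ (suc x) = Wf-rename suc-injective (σ x) (wσ x)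

Wf-subst : {σ : Fin m → Ty n} → (∀ x → Wf (σ x)) → ∀ A → Wf A → Wf (subst σ A)
Wf-subst wσ (var x) w         = wσ x
Wf-subst wσ (A ⇒ B) (w₁ , w₂) = Wf-subst wσ A w₁ , Wf-subst wσ B w₂
Wf-subst wσ (∀̇ A)   w         = Wf-subst (Wf-liftₛ wσ) A w
Wf-subst wσ 𝟘       w         = tt
Wf-subst wσ 𝟙       w         = tt
Wf-subst wσ (A ⊕ B) (w₁ , w₂) = Wf-subst wσ A w₁ , Wf-subst wσ B w₂
Wf-subst wσ (A ⊗ B) (w₁ , w₂) = Wf-subst wσ A w₁ , Wf-subst wσ B w₂
Wf-subst wσ (μ̇ A)   (o , w)   = Only-subst-zero A o , Wf-subst (Wf-liftₛ wσ) A w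
Wf-subst wσ (ν̇ A)   (o , w)   = Only-subst-zero A o , Wf-subst (Wf-liftₛ wσ) A w

∀-free-liftₛ : {σ : Fin m → Ty n} → (∀ x → ∀-free (σ x)) → ∀ x → ∀-free (liftₛ σ x)
∀-free-liftₛ fσ zero    = tt
∀-free-liftₛ {σ = σ} fσ (suc x) = ∀-free-rename (σ x) (fσ x)

∀-free-subst : {σ : Fin m → Ty n} → (∀ x → ∀-free (σ x)) → ∀ A → ∀-free A → ∀-free (subst σ A)
∀-free-subst fσ (var x) f         = fσ x
∀-free-subst fσ (A ⇒ B) (f₁ , f₂) = ∀-free-subst fσ A f₁ , ∀-free-subst fσ B f₂
∀-free-subst fσ 𝟘       f         = tt
∀-free-subst fσ 𝟙       f         = tt
∀-free-subst fσ (A ⊕ B) (f₁ , f₂) = ∀-free-subst fσ A f₁ , ∀-free-subst fσ B f₂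
∀-free-subst fσ (A ⊗ B) (f₁ , f₂) = ∀-free-subst fσ A f₁ , ∀-free-subst fσ B f₂
∀-free-subst fσ (μ̇ A)   f         = ∀-free-subst (∀-free-liftₛ fσ) A f
∀-free-subst fσ (ν̇ A)   f         = ∀-free-subst (∀-free-liftₛ fσ) A f

-- Strengthening and the optional binders.

PartialInverse : (Fin m → Maybe (Fin n)) → (Fin n → Fin m) → Set
PartialInverse ρ ι = ∀ x {y} → ρ x ≡ just y → x ≡ ι y

lift?-inverse : {ρ : Fin m → Maybe (Fin n)} {ι : Fin n → Fin m} →
                PartialInverse ρ ι → PartialInverse (lift? ρ) (lift ι)
lift?-inverse inv zero refl = refl
lift?-inverse {ρ = ρ} inv (suc x) eq with ρ x in ρx≡
lift?-inverse inv (suc x) refl | just y = cong suc (inv x ρx≡)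

drop-zero-inverse : PartialInverse {suc n} drop-zero suc
drop-zero-inverse (suc x) refl = refl

-- For `drop-zero` and `suc` this says that a successful `strengthen` exhibits its argument as a
-- weakening. Arbitrary `ρ` and `ι` appear because passing under a binder lifts both.
rename?-inverse : {ρ : Fin m → Maybe (Fin n)} {ι : Fin n → Fin m} → PartialInverse ρ ι →
                  ∀ A {A′} → rename? ρ A ≡ just A′ → A ≡ rename ι A′
rename?-inverse {ρ = ρ} inv (var x) eq with ρ x in ρx≡
rename?-inverse inv (var x) refl | just y = cong var (inv x ρx≡)
rename?-inverse {ρ = ρ} inv (A ⇒ B) eq with rename? ρ A in a | rename? ρ B in b
rename?-inverse inv (A ⇒ B) refl | just _ | just _ =
  cong₂ _⇒_ (rename?-inverse inv A a) (rename?-inverse inv B b)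
rename?-inverse {ρ = ρ} inv (∀̇ A) eq with rename? (lift? ρ) A in a
rename?-inverse inv (∀̇ A) refl | just _ = cong ∀̇_ (rename?-inverse (lift?-inverse inv) A a)
rename?-inverse inv 𝟘 refl = refl
rename?-inverse inv 𝟙 refl = refl
rename?-inverse {ρ = ρ} inv (A ⊕ B) eq with rename? ρ A in a | rename? ρ B in b
rename?-inverse inv (A ⊕ B) refl | just _ | just _ =
  cong₂ _⊕_ (rename?-inverse inv A a) (rename?-inverse inv B b)
rename?-inverse {ρ = ρ} inv (A ⊗ B) eq with rename? ρ A in a | rename? ρ B in b
rename?-inverse inv (A ⊗ B) refl | just _ | just _ =
  cong₂ _⊗_ (rename?-inverse inv A a) (rename?-inverse inv B b)
rename?-inverse {ρ = ρ} inv (μ̇ A) eq with rename? (lift? ρ) A in a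
rename?-inverse inv (μ̇ A) refl | just _ = cong μ̇_ (rename?-inverse (lift?-inverse inv) A a)
rename?-inverse {ρ = ρ} inv (ν̇ A) eq with rename? (lift? ρ) A in a
rename?-inverse inv (ν̇ A) refl | just _ = cong ν̇_ (rename?-inverse (lift?-inverse inv) A a)

mutual
  renameNf?-inverse : {ρ : Fin m → Maybe (Fin n)} {ι : Fin n → Fin m} → PartialInverse ρ ι →
                      ∀ A {A′} → renameNf? ρ A ≡ just A′ → A ≡ renameNf ι A′
  renameNf?-inverse {ρ = ρ} inv (∀̇ A) eq with renameNf? (lift? ρ) A in a
  renameNf?-inverse inv (∀̇ A) refl | just _ =
    cong ∀̇_ (renameNf?-inverse (lift?-inverse inv) A a)
  renameNf?-inverse {ρ = ρ} inv ⌊ E ⌋ eq with renameNe? ρ E in e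
  renameNf?-inverse inv ⌊ E ⌋ refl | just _ = cong ⌊_⌋ (renameNe?-inverse inv E e)

  renameNe?-inverse : {ρ : Fin m → Maybe (Fin n)} {ι : Fin n → Fin m} → PartialInverse ρ ι →
                      ∀ E {E′} → renameNe? ρ E ≡ just E′ → E ≡ renameNe ι E′
  renameNe?-inverse {ρ = ρ} inv (var x) eq with ρ x in ρx≡
  renameNe?-inverse inv (var x) refl | just y = cong var (inv x ρx≡)
  renameNe?-inverse {ρ = ρ} inv (A ⇒ E) eq with renameNf? ρ A in a | renameNe? ρ E in e
  renameNe?-inverse inv (A ⇒ E) refl | just _ | just _ =
    cong₂ _⇒_ (renameNf?-inverse inv A a) (renameNe?-inverse inv E e)

Only-μ? : ∀ {x} (A : Ty (suc n)) → Only s (suc x) A → Only s x (μ? A)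
Only-μ? A o with strengthen A in eq
... | nothing = o
... | just A′ with rename?-inverse drop-zero-inverse A eq
...   | refl = Only-rename⁻ A′ o

Only-ν? : ∀ {x} (A : Ty (suc n)) → Only s (suc x) A → Only s x (ν? A)
Only-ν? A o with strengthen A in eq
... | nothing = o
... | just A′ with rename?-inverse drop-zero-inverse A eq
...   | refl = Only-rename⁻ A′ o

Λpμν-μ? : (A : Ty (suc n)) → Only pos zero A → Λpμν A → Λpμν (μ? A)
Λpμν-μ? A o (w , f) with strengthen A in eq
... | nothing = (o , w) , f
... | just A′ with rename?-inverse drop-zero-inverse A eq
...   | refl = Wf-rename⁻ A′ w , ∀-free-rename⁻ A′ f

Λpμν-ν? : (A : Ty (suc n)) → Only pos zero A → Λpμν A → Λpμν (ν? A)
Λpμν-ν? A o (w , f) with strengthen A in eq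
... | nothing = (o , w) , f
... | just A′ with rename?-inverse drop-zero-inverse A eq
...   | refl = Wf-rename⁻ A′ w , ∀-free-rename⁻ A′ f

-- Eliminating a block of quantifiers

Wf-⇒* : {As : List (Ty n)} {B : Ty n} → All Wf As → Wf B → Wf (As ⇒* B)
Wf-⇒* []       w = w
Wf-⇒* (v ∷ vs) w = v , Wf-⇒* vs w

∀-free-⇒* : {As : List (Ty n)} {B : Ty n} → All ∀-free As → ∀-free B → ∀-free (As ⇒* B)
∀-free-⇒* []       f = f
∀-free-⇒* (g ∷ gs) f = g , ∀-free-⇒* gs f

Λpμν-⇒* : {As : List (Ty n)} {B : Ty n} → All Λpμν As → Λpμν B → Λpμν (As ⇒* B)
Λpμν-⇒* vs (w , f) = Wf-⇒* (All.map proj₁ vs) w , ∀-free-⇒* (All.map proj₂ vs) f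

Only-⇒* : {As : List (Ty n)} {B : Ty n} → ∀ {x} →
          All (Only (opposite s) x) As → Only s x B → Only s x (As ⇒* B)
Only-⇒* []       o = o
Only-⇒* (p ∷ ps) o = p , Only-⇒* ps o

⇒-⇒*-swap : (A : Ty n) (As : List (Ty n)) (B : Ty n) → Wf A → All Wf As → Wf B →
            A ⇒ (As ⇒* B) ≡Y As ⇒* (A ⇒ B)
⇒-⇒*-swap A []       B v []       w = refl (v , w)
⇒-⇒*-swap A (C ∷ Cs) B v (u ∷ us) w = trans
  (axiom (v , u , Wf-⇒* us w) (u , v , Wf-⇒* us w) (⇒-swap A C (Cs ⇒* B)))
  (⇒-cong (refl u) (⇒-⇒*-swap A Cs B v us w))

∀^-cong : ∀ k {A B : Ty (k + n)} → A ≡Y B → ∀^ k A ≡Y ∀^ k B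
∀^-cong zero    e = e
∀^-cong (suc k) e = ∀^-cong k (∀-cong e)

-- Since inner quantifiers are eliminated first, the clauses of Y⁺ and Y⁻ are
-- needed only without quantifiers.
Payload : Sign → ℕ → Set
Payload pos n = List (Ty n)
Payload neg n = Ty n

hyp : ∀ σ → Fin n → Payload σ n → Ty n
hyp pos X As = As ⇒* var X
hyp neg X A  = var X ⇒ A

PayloadΛpμν : ∀ σ → Payload σ n → Set
PayloadΛpμν pos As = All Λpμν As
PayloadΛpμν neg A  = Λpμν A

-- The signs are those of the occurrences in hyp σ X p ⇒ B.
PayloadOnly : Sign → Fin n → ∀ σ → Payload σ n → Set
PayloadOnly s x pos As = All (Only s x) As
PayloadOnly s x neg A  = Only (opposite s) x A

mapPayload : (Ty m → Ty n) → ∀ σ → Payload σ m → Payload σ n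
mapPayload f pos = map f
mapPayload f neg = f

Λpμν-hyp : ∀ σ {X : Fin n} {p} → PayloadΛpμν σ p → Λpμν (hyp σ X p)
Λpμν-hyp pos vs = Λpμν-⇒* vs (tt , tt)
Λpμν-hyp neg v  = (tt , proj₁ v) , (tt , proj₂ v)

-- These are the solutions of Y⁺ and Y⁻ for `m = 0` and clauses without quantifiers. The renaming
-- `to-front 0` fixes every variable, and is kept so that the axioms apply literally.
solution : ∀ σ → List (Payload σ (suc n)) → Ty n
solution pos Ass = μ? (rename (to-front 0) (sol⁺ (map (0 ,_) Ass)))
solution neg As  = ν? (rename (to-front 0) (sol⁻ (map (0 ,_) As)))

infix 24 _[_]₀

_[_]₀ : Ty (suc n) → Ty n → Ty n
A [ T ]₀ = rename (to-front 0) A [ T ]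

module _ (P : Ty n → Set) (P-⊗ : ∀ {A B} → P A → P B → P (A ⊗ B)) (P-𝟙 : P 𝟙) where
  ∏-closed : {As : List (Ty n)} → All P As → P (∏ As)
  ∏-closed []               = P-𝟙
  ∏-closed (p ∷ [])         = p
  ∏-closed (p ∷ ps@(_ ∷ _)) = P-⊗ p (∏-closed ps)

module _ (P : Ty n → Set) (P-⊕ : ∀ {A B} → P A → P B → P (A ⊕ B)) (P-𝟘 : P 𝟘) where
  ∑-closed : {As : List (Ty n)} → All P As → P (∑ As)
  ∑-closed []               = P-𝟘
  ∑-closed (p ∷ [])         = p
  ∑-closed (p ∷ ps@(_ ∷ _)) = P-⊕ p (∑-closed ps)

Λpμν-sol⁺ : {Ass : List (List (Ty n))} → All (All Λpμν) Ass → Λpμν (sol⁺ (map (0 ,_) Ass))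
Λpμν-sol⁺ vs = ∑-closed Λpμν pair _ (map⁺ (map⁺ (All.map (∏-closed Λpμν pair _) vs)))
  where
  pair : {A B C D : Set} → A × B → C × D → (A × C) × (B × D)
  pair (a , b) (c , d) = (a , c) , (b , d)

Λpμν-sol⁻ : {As : List (Ty n)} → All Λpμν As → Λpμν (sol⁻ (map (0 ,_) As))
Λpμν-sol⁻ vs = ∏-closed Λpμν (λ (a , b) (c , d) → (a , c) , (b , d)) _ (map⁺ (map⁺ vs))

Only-sol⁺ : ∀ {x} {Ass : List (List (Ty n))} → All (All (Only s x)) Ass →
            Only s x (sol⁺ (map (0 ,_) Ass))
Only-sol⁺ os = ∑-closed (Only _ _) _,_ _ (map⁺ (map⁺ (All.map (∏-closed (Only _ _) _,_ _) os)))

Only-sol⁻ : ∀ {x} {As : List (Ty n)} → All (Only s x) As → Only s x (sol⁻ (map (0 ,_) As))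
Only-sol⁻ os = ∏-closed (Only _ _) _,_ _ (map⁺ (map⁺ os))

Only-to-front : ∀ {x} (A : Ty (suc n)) → Only s x A → Only s x (rename (to-front 0) A)
Only-to-front A = Only-rename (λ eq → eq) A

Λpμν-to-front : (A : Ty (suc n)) → Λpμν A → Λpμν (rename (to-front 0) A)
Λpμν-to-front A (w , f) = Wf-rename (λ eq → eq) A w , ∀-free-rename A f

-- For either value of `σ`, `PayloadOnly σ zero σ` amounts to positivity of the eliminated variable
-- in the payload, which is what `μ̇` and `ν̇` require.
Λpμν-solution : ∀ σ {ps : List (Payload σ (suc n))} → All (PayloadΛpμν σ) ps →
                All (PayloadOnly σ zero σ) ps → Λpμν (solution σ ps)
Λpμν-solution pos {Ass} vs os = let S = sol⁺ (map (0 ,_) Ass) in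
  Λpμν-μ? (rename (to-front 0) S) (Only-to-front S (Only-sol⁺ os)) (Λpμν-to-front S (Λpμν-sol⁺ vs))
Λpμν-solution neg {As} vs os = let S = sol⁻ (map (0 ,_) As) in
  Λpμν-ν? (rename (to-front 0) S) (Only-to-front S (Only-sol⁻ os)) (Λpμν-to-front S (Λpμν-sol⁻ vs))

-- The sign `σ * s` is the one that `OnlyAfter` demands of a type substituted at occurrences of sign
-- `σ`. So solving for one variable respects the signs of all the others.
Only-solution : ∀ σ {x} {ps : List (Payload σ (suc n))} → All (PayloadOnly s (suc x) σ) ps →
                Only (σ * s) x (solution σ ps)
Only-solution pos {ps = Ass} os = let S = sol⁺ (map (0 ,_) Ass) in
  Only-μ? (rename (to-front 0) S) (Only-to-front S (Only-sol⁺ os))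
Only-solution neg {ps = As} os = let S = sol⁻ (map (0 ,_) As) in
  Only-ν? (rename (to-front 0) S) (Only-to-front S (Only-sol⁻ os))

Only-[]₀ : ∀ {σ x T} (A : Ty (suc n)) → Only σ zero A → Only s (suc x) A → Only (σ * s) x T →
           Only s x (A [ T ]₀)
Only-[]₀ {s = s} {σ} {x} {T} A o₀ o p = Only-subst (rename (to-front 0) A) λ where
    .OnlyAfter.at zero    → inj₂ (σ , Only-to-front A o₀ , p)
    .OnlyAfter.at (suc y) → other-variable y
  where
  other-variable : ∀ y → (∀ e → Only e x (var y)) ⊎
    (∃[ e ] (Only e (suc y) (rename (to-front 0) A) × Only (e * s) x (var y)))
  other-variable y with x ≟ y
  -- A variable of sign `s` that is mapped to itself must have sign `s * s` in its image, which is
  -- `pos`.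
  ... | yes refl = inj₂ (s , Only-to-front A o , λ _ → s*s≡+ s)
  ... | no  x≢y  = inj₁ λ e x≡y → contradiction x≡y x≢y

Λpμν-[]₀ : ∀ {T} (A : Ty (suc n)) → Λpμν T → Λpμν A → Λpμν (A [ T ]₀)
Λpμν-[]₀ A (w , f) v =
  Wf-subst (λ { zero → w ; (suc x) → tt }) (rename (to-front 0) A) (proj₁ (Λpμν-to-front A v)) ,
  ∀-free-subst (λ { zero → f ; (suc x) → tt }) (rename (to-front 0) A) (proj₂ (Λpμν-to-front A v))

⇒*-[]₀ : ∀ {T} (As : List (Ty (suc n))) {B} →
         (As ⇒* B) [ T ]₀ ≡ map (_[ T ]₀) As ⇒* B [ T ]₀
⇒*-[]₀ []       = refl
⇒*-[]₀ (A ∷ As) = cong (_ ⇒_) (⇒*-[]₀ As)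

hyp-[]₀ : ∀ {T} σ {X : Fin n} (p : Payload σ (suc n)) →
          hyp σ (suc X) p [ T ]₀ ≡ hyp σ X (mapPayload (_[ T ]₀) σ p)
hyp-[]₀ pos As = ⇒*-[]₀ As
hyp-[]₀ neg A  = refl

-- One instance of Y⁺ or Y⁻ with `m = 0`: the other quantifiers of the block stay outside, and the
-- equivalence is used under them by congruence.
solution-≡Y : ∀ σ {ps : List (Payload σ (suc n))} {B} → All (PayloadΛpμν σ) ps → Λpμν B →
              All (PayloadOnly σ zero σ) ps → Only σ zero B →
              ∀̇ (map (hyp σ zero) ps ⇒* B) ≡Y B [ solution σ ps ]₀
solution-≡Y pos {ps} {B} vs v os o = axiom
  (Wf-⇒* (map⁺ (All.map (λ {p} → proj₁ ∘ Λpμν-hyp pos {zero} {p}) vs)) (proj₁ v))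
  (proj₁ (Λpμν-[]₀ B (Λpμν-solution pos vs os) v))
  (≡.subst (λ Cs → Axiom (∀̇ (Cs ⇒* B)) (B [ solution pos ps ]₀)) (≡.sym (map-∘ ps))
    (Y⁺ 0 (map (0 ,_) ps) B (map⁺ os) o))
solution-≡Y neg {ps} {B} vs v os o = axiom
  (Wf-⇒* (map⁺ (All.map (λ {p} → proj₁ ∘ Λpμν-hyp neg {zero} {p}) vs)) (proj₁ v))
  (proj₁ (Λpμν-[]₀ B (Λpμν-solution neg vs os) v))
  (≡.subst (λ Cs → Axiom (∀̇ (Cs ⇒* B)) (B [ solution neg ps ]₀)) (≡.sym (map-∘ ps))
    (Y⁻ 0 (map (0 ,_) ps) B (map⁺ os) o))

PayloadΛpμν-[]₀ : ∀ {T} σ {p : Payload σ (suc n)} → Λpμν T → PayloadΛpμν σ p →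
                  PayloadΛpμν σ (mapPayload (_[ T ]₀) σ p)
PayloadΛpμν-[]₀ pos t vs = map⁺ (All.map (λ {A} → Λpμν-[]₀ A t) vs)
PayloadΛpμν-[]₀ neg {A} t v  = Λpμν-[]₀ A t v

Only-[]₀-opposite : ∀ {σ x T} (A : Ty (suc n)) → Only (opposite σ) zero A →
                    Only (opposite s) (suc x) A → Only (σ * s) x T →
                    Only (opposite s) x (A [ T ]₀)
Only-[]₀-opposite {s = s} {σ} {x} {T} A o₀ o p =
  Only-[]₀ A o₀ o (≡.subst (λ e → Only e x T) (≡.sym (opposite-*-opposite σ s)) p)

PayloadOnly-[]₀ : ∀ {τ x T} σ {p : Payload σ (suc n)} → PayloadOnly τ zero σ p →
                  PayloadOnly s (suc x) σ p → Only (τ * s) x T →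
                  PayloadOnly s x σ (mapPayload (_[ T ]₀) σ p)
PayloadOnly-[]₀ pos os₀ os t = map⁺ (All.zipWith (λ {A} (o₀ , o) → Only-[]₀ A o₀ o t) (os₀ , os))
PayloadOnly-[]₀ neg {A} o₀  o  t = Only-[]₀-opposite A o₀ o t

-- Clauses for a whole block of variables.

module _ (σ : Fin m → Sign) where

  Hyp : ℕ → Set
  Hyp n = Σ[ z ∈ Fin m ] Payload (σ z) n

  -- The embedding `ι` is a parameter because the variables other than `zero` sit at `suc ∘ (_↑ˡ n)`
  -- until `zero` has been substituted away, and at `_↑ˡ n` afterwards.
  ⟦_⟧ : (Fin m → Fin n) → Hyp n → Ty n
  ⟦ ι ⟧ (z , p) = hyp (σ z) (ι z) p

  HypΛpμν : Hyp n → Set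
  HypΛpμν (z , p) = PayloadΛpμν (σ z) p

  HypOnly : Sign → Fin n → Hyp n → Set
  HypOnly s x (z , p) = PayloadOnly s x (σ z) p

  mapHyp : ∀ {k} → (Ty k → Ty n) → Hyp k → Hyp n
  mapHyp f (z , p) = z , mapPayload f (σ z) p

at-zero : {σ : Fin (suc m) → Sign} → List (Hyp σ n) → List (Payload (σ zero) n)
at-zero []                 = []
at-zero ((zero  , p) ∷ Hs) = p ∷ at-zero Hs
at-zero ((suc z , p) ∷ Hs) = at-zero Hs

at-suc : {σ : Fin (suc m) → Sign} → List (Hyp σ n) → List (Hyp (σ ∘ suc) n)
at-suc []                 = []
at-suc ((zero  , p) ∷ Hs) = at-suc Hs
at-suc ((suc z , p) ∷ Hs) = (z , p) ∷ at-suc Hs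

All-at-zero : {σ : Fin (suc m) → Sign} {P : Hyp σ n → Set} {Hs : List (Hyp σ n)} →
              All P Hs → All (λ p → P (zero , p)) (at-zero Hs)
All-at-zero []                               = []
All-at-zero {Hs = (zero  , p) ∷ Hs} (q ∷ qs) = q ∷ All-at-zero qs
All-at-zero {Hs = (suc z , p) ∷ Hs} (q ∷ qs) = All-at-zero qs

All-at-suc : {σ : Fin (suc m) → Sign} {P : Hyp σ n → Set} {Hs : List (Hyp σ n)} →
             All P Hs → All (λ (z , p) → P (suc z , p)) (at-suc Hs)
All-at-suc []                               = []
All-at-suc {Hs = (zero  , p) ∷ Hs} (q ∷ qs) = All-at-suc qs
All-at-suc {Hs = (suc z , p) ∷ Hs} (q ∷ qs) = q ∷ All-at-suc qs

-- The Y axioms expect the clauses of the eliminated variable in front of all other arguments;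
-- `⇒-swap` moves them there.
partition-≡Y : {σ : Fin (suc m) → Sign} (ι : Fin (suc m) → Fin n) {B : Ty n} {Hs : List (Hyp σ n)} →
  All (HypΛpμν σ) Hs → Wf B →
  map (⟦ σ ⟧ ι) Hs ⇒* B ≡Y
  map (hyp (σ zero) (ι zero)) (at-zero Hs) ⇒* (map (⟦ σ ∘ suc ⟧ (ι ∘ suc)) (at-suc Hs) ⇒* B)
partition-≡Y ι [] w = refl w
partition-≡Y {σ = σ} ι {Hs = (zero , p) ∷ Hs} (v ∷ vs) w =
  ⇒-cong (refl (proj₁ (Λpμν-hyp (σ zero) v))) (partition-≡Y ι vs w)
partition-≡Y {σ = σ} ι {Hs = (suc z , p) ∷ Hs} (v ∷ vs) w = trans
  (⇒-cong (refl (proj₁ (Λpμν-hyp (σ (suc z)) v))) (partition-≡Y ι vs w))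
  (⇒-⇒*-swap _ _ _ (proj₁ (Λpμν-hyp (σ (suc z)) v))
    (map⁺ (All.map (λ {p} → proj₁ ∘ Λpμν-hyp (σ zero)) (All-at-zero vs)))
    (Wf-⇒* (map⁺ (All.map (λ {(z , p)} → proj₁ ∘ Λpμν-hyp (σ (suc z))) (All-at-suc vs))) w))

-- Arguments and head are kept apart so that the enclosing root can still read the result as a
-- clause of Y⁺: by `headVar` a head variable from outside the block survives, and `onlyArgs`
-- controls the arguments whatever the signs in the head.
record Eliminated (σ : Fin m → Sign) (Hs : List (Hyp σ (m + n))) (Ns : List (Ty (m + n)))
                  (H : Ty (m + n)) : Set where
  field
    args     : List (Ty n)
    head     : Ty n
    args-ok  : All Λpμν args
    head-ok  : Λpμν head
    equiv    : ∀^ m (map (⟦ σ ⟧ (_↑ˡ n)) Hs ⇒* (Ns ⇒* H)) ≡Y args ⇒* head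
    onlyArgs : ∀ {s x} → All (HypOnly σ s (m ↑ʳ x)) Hs → All (Only (opposite s) (m ↑ʳ x)) Ns →
               All (Only (opposite s) x) args
    onlyHead : ∀ {s x} → All (HypOnly σ s (m ↑ʳ x)) Hs → Only s (m ↑ʳ x) H → Only s x head
    headVar  : ∀ {x} → H ≡ var (m ↑ʳ x) → head ≡ var x

-- Induction on the size of the block, starting with the innermost variable `zero`. A clause of one
-- variable may mention the others, so the sign conditions range over all variables of the block in
-- all clauses, and each substitution has to preserve them.
eliminate : ∀ m {n} (σ : Fin m → Sign) (Hs : List (Hyp σ (m + n))) (Ns : List (Ty (m + n)))
            (H : Ty (m + n)) →
            All (HypΛpμν σ) Hs → All Λpμν Ns → Λpμν H →
            (∀ z → All (HypOnly σ (σ z) (z ↑ˡ n)) Hs) →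
            (∀ z → All (Only (opposite (σ z)) (z ↑ˡ n)) Ns) →
            (∀ z → Only (σ z) (z ↑ˡ n) H) →
            Eliminated σ Hs Ns H
-- Every clause names a variable of the block, so an empty block has no clauses.
eliminate zero σ [] Ns H _ vNs vH _ _ _ = record
  { args = Ns ; head = H ; args-ok = vNs ; head-ok = vH
  ; equiv = refl (proj₁ (Λpμν-⇒* vNs vH))
  ; onlyArgs = λ _ os → os ; onlyHead = λ _ o → o ; headVar = λ eq → eq }
eliminate (suc m) {n} σ Hs Ns H vHs vNs vH oHs oNs oH = record
  { args = IH.args ; head = IH.head ; args-ok = IH.args-ok ; head-ok = IH.head-ok
  ; equiv = trans (∀^-cong m step) IH.equiv
  ; onlyArgs = λ os₁ os₂ → IH.onlyArgs (onlyHs os₁) (onlyNs os₁ os₂)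
  ; onlyHead = λ os o → IH.onlyHead (onlyHs os) (onlyH os o)
  ; headVar = λ { refl → IH.headVar refl } }
  where
  ps = at-zero Hs
  T = solution (σ zero) ps
  σ′ = σ ∘ suc
  Hs₁ = at-suc Hs
  Hs′ = map (mapHyp σ′ (_[ T ]₀)) Hs₁
  Ns′ = map (_[ T ]₀) Ns
  H′ = H [ T ]₀

  vps : All (PayloadΛpμν (σ zero)) ps
  vps = All-at-zero vHs

  vT : Λpμν T
  vT = Λpμν-solution (σ zero) vps (All-at-zero (oHs zero))

  -- This serves twice: for the remaining variables of the block, with `s` their chosen sign, and
  -- for variables from outside, with arbitrary `s`.
  module _ {s x} (os : All (HypOnly σ s (suc x)) Hs) where
    onlyT : Only (σ zero * s) x T
    onlyT = Only-solution (σ zero) (All-at-zero os)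

    onlyHs : All (HypOnly σ′ s x) Hs′
    onlyHs = map⁺ (All.zipWith
      (λ {(z , p)} (o₀ , o) → PayloadOnly-[]₀ {τ = σ zero} (σ′ z) o₀ o onlyT)
      (All-at-suc (oHs zero) , All-at-suc os))

    onlyNs : All (Only (opposite s) (suc x)) Ns → All (Only (opposite s) x) Ns′
    onlyNs os′ = map⁺ (All.zipWith
      (λ {N} (o₀ , o) → Only-[]₀-opposite {σ = σ zero} N o₀ o onlyT) (oNs zero , os′))

    onlyH : Only s (suc x) H → Only s x H′
    onlyH o = Only-[]₀ {σ = σ zero} H (oH zero) o onlyT

  rest : Eliminated σ′ Hs′ Ns′ H′
  rest = eliminate m {n} σ′ Hs′ Ns′ H′
    (map⁺ (All.map (λ {(z , p)} → PayloadΛpμν-[]₀ (σ′ z) vT) (All-at-suc vHs)))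
    (map⁺ (All.map (λ {N} → Λpμν-[]₀ N vT) vNs)) (Λpμν-[]₀ H vT vH)
    (λ z → onlyHs (oHs (suc z)))
    (λ z → onlyNs (oHs (suc z)) (oNs (suc z)))
    (λ z → onlyH (oHs (suc z)) (oH (suc z)))

  module IH = Eliminated rest

  B = map (⟦ σ′ ⟧ (suc ∘ (_↑ˡ n))) Hs₁ ⇒* (Ns ⇒* H)

  substituted : ∀ Hs → (map (⟦ σ′ ⟧ (suc ∘ (_↑ˡ n))) Hs ⇒* (Ns ⇒* H)) [ T ]₀ ≡
                       map (⟦ σ′ ⟧ (_↑ˡ n)) (map (mapHyp σ′ (_[ T ]₀)) Hs) ⇒* (Ns′ ⇒* H′)
  substituted []             = ⇒*-[]₀ Ns
  substituted ((z , p) ∷ Hs) = cong₂ _⇒_ (hyp-[]₀ (σ′ z) p) (substituted Hs)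

  -- The clauses of the other variables belong to the body `B` of the axiom. They are arguments
  -- there, so `zero` must have in them the sign opposite to `σ zero`.
  onlyHyp : ∀ τ {X : Fin (m + n)} {p : Payload τ (suc m + n)} →
            PayloadOnly (σ zero) zero τ p → Only (opposite (σ zero)) zero (hyp τ (suc X) p)
  onlyHyp pos os =
    Only-⇒* (≡.subst (λ e → All (Only e zero) _) (≡.sym (opposite-involutive _)) os) λ ()
  onlyHyp neg o  = (λ ()) , o

  step : ∀̇ (map (⟦ σ ⟧ (_↑ˡ n)) Hs ⇒* (Ns ⇒* H)) ≡Y
         map (⟦ σ′ ⟧ (_↑ˡ n)) Hs′ ⇒* (Ns′ ⇒* H′)
  step = trans
    (∀-cong (partition-≡Y (_↑ˡ n) vHs (proj₁ (Λpμν-⇒* vNs vH))))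
    (≡.subst (∀̇ (map (hyp (σ zero) zero) ps ⇒* B) ≡Y_) (substituted Hs₁)
      (solution-≡Y (σ zero) {B = B} vps
        (Λpμν-⇒* (map⁺ (All.map (λ {(z , p)} → Λpμν-hyp (σ′ z)) (All-at-suc vHs)))
                 (Λpμν-⇒* vNs vH))
        (All-at-zero (oHs zero))
        (Only-⇒* (map⁺ (All.map (λ {(z , p)} → onlyHyp (σ′ z)) (All-at-suc (oHs zero))))
                 (Only-⇒* (oNs zero) (oH zero)))))

-- Reducing coherent normal forms

mutual
  ⌈_⌉ : Nf n → Ty n
  ⌈ ∀̇ A ⌉   = ∀̇ ⌈ A ⌉
  ⌈ ⌊ E ⌋ ⌉ = ⌈ E ⌉ₑ

  ⌈_⌉ₑ : Ne n → Ty n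
  ⌈ var x ⌉ₑ = var x
  ⌈ A ⇒ E ⌉ₑ = ⌈ A ⌉ ⇒ ⌈ E ⌉ₑ

mutual
  ⌈⌉-rename : (ρ : Fin m → Fin n) → ∀ A → ⌈ renameNf ρ A ⌉ ≡ rename ρ ⌈ A ⌉
  ⌈⌉-rename ρ (∀̇ A) = cong ∀̇_ (⌈⌉-rename (lift ρ) A)
  ⌈⌉-rename ρ ⌊ E ⌋ = ⌈⌉ₑ-rename ρ E

  ⌈⌉ₑ-rename : (ρ : Fin m → Fin n) → ∀ E → ⌈ renameNe ρ E ⌉ₑ ≡ rename ρ ⌈ E ⌉ₑ
  ⌈⌉ₑ-rename ρ (var x) = refl
  ⌈⌉ₑ-rename ρ (A ⇒ E) = cong₂ _⇒_ (⌈⌉-rename ρ A) (⌈⌉ₑ-rename ρ E)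

mutual
  Wf-⌈⌉ : (A : Nf n) → Wf ⌈ A ⌉
  Wf-⌈⌉ (∀̇ A) = Wf-⌈⌉ A
  Wf-⌈⌉ ⌊ E ⌋ = Wf-⌈⌉ₑ E

  Wf-⌈⌉ₑ : (E : Ne n) → Wf ⌈ E ⌉ₑ
  Wf-⌈⌉ₑ (var x) = tt
  Wf-⌈⌉ₑ (A ⇒ E) = Wf-⌈⌉ A , Wf-⌈⌉ₑ E

⇒ₙ-≡Y : (A B : Nf n) → ⌈ A ⌉ ⇒ ⌈ B ⌉ ≡Y ⌈ A ⇒ₙ B ⌉
⇒ₙ-≡Y A (∀̇ B) = trans
  (axiom (Wf-⌈⌉ A , Wf-⌈⌉ B) (Wf-rename suc-injective ⌈ A ⌉ (Wf-⌈⌉ A) , Wf-⌈⌉ B) (⇒-∀ ⌈ A ⌉ ⌈ B ⌉))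
  (∀-cong (≡.subst (λ C → C ⇒ ⌈ B ⌉ ≡Y ⌈ renameNf suc A ⇒ₙ B ⌉) (⌈⌉-rename suc A)
    (⇒ₙ-≡Y (renameNf suc A) B)))
⇒ₙ-≡Y A ⌊ E ⌋ = refl (Wf-⌈⌉ A , Wf-⌈⌉ₑ E)

quantify-≡Y : (A : Nf (suc n)) → ∀̇ ⌈ A ⌉ ≡Y ⌈ quantify A ⌉
quantify-≡Y A with renameNf? drop-zero A in eq
... | nothing = refl (Wf-⌈⌉ A)
... | just A′ with renameNf?-inverse drop-zero-inverse A eq
...   | refl rewrite ⌈⌉-rename suc A′ =
  sym (axiom (Wf-⌈⌉ A′) (Wf-rename suc-injective ⌈ A′ ⌉ (Wf-⌈⌉ A′)) (∀-vac ⌈ A′ ⌉))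

nf-≡Y : {A : Ty n} (A∈Λ2 : Λ2 A) → A ≡Y ⌈ nf A∈Λ2 ⌉
nf-≡Y (var x) = refl tt
nf-≡Y (A ⇒ B) = trans (⇒-cong (nf-≡Y A) (nf-≡Y B)) (⇒ₙ-≡Y (nf A) (nf B))
nf-≡Y (∀̇ A)   = trans (∀-cong (nf-≡Y A)) (quantify-≡Y (nf A))

headₑ : Ne n → Fin n
headₑ (var x) = x
headₑ (A ⇒ E) = headₑ E

HeadIs : Fin n → Nf n → Set
HeadIs x (∀̇ A) = HeadIs (suc x) A
HeadIs x ⌊ E ⌋ = headₑ E ≡ x

-- The head is left out and `s` is counted inside each argument: for a clause `As ⇒ X`, Y⁺ restricts
-- the signs in `As` only.
ArgsOnlyₑ : Sign → Fin n → Ne n → Set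
ArgsOnlyₑ s x (var y) = ⊤
ArgsOnlyₑ s x (A ⇒ E) = Only s x ⌈ A ⌉ × ArgsOnlyₑ s x E

ArgsOnly : Sign → Fin n → Nf n → Set
ArgsOnly s x (∀̇ A) = ArgsOnly s (suc x) A
ArgsOnly s x ⌊ E ⌋ = ArgsOnlyₑ s x E

Only⇒ArgsOnlyₑ : ∀ {x} (E : Ne n) → Only s x ⌈ E ⌉ₑ → ArgsOnlyₑ (opposite s) x E
Only⇒ArgsOnlyₑ (var y) o        = tt
Only⇒ArgsOnlyₑ (A ⇒ E) (o , o′) = o , Only⇒ArgsOnlyₑ E o′

Only⇒ArgsOnly : ∀ {x} (A : Nf n) → Only s x ⌈ A ⌉ → ArgsOnly (opposite s) x A
Only⇒ArgsOnly (∀̇ A) = Only⇒ArgsOnly A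
Only⇒ArgsOnly ⌊ E ⌋ = Only⇒ArgsOnlyₑ E

Only⇒headₑ : ∀ {x} (E : Ne n) → Only s x ⌈ E ⌉ₑ → Only s x (var (headₑ E))
Only⇒headₑ (var y) o       = o
Only⇒headₑ (A ⇒ E) (_ , o) = Only⇒headₑ E o

-- Deleting one argument `var x` exhibits a normal form as a clause `X ⇒ A` of Y⁻, up to the order
-- of arguments and the place of quantifiers.
data Removesₑ (x : Fin n) : Ne n → Ne n → Set where
  here  : ∀ {E} → Removesₑ x (⌊ var x ⌋ ⇒ E) E
  there : ∀ {A E E⁻} → Removesₑ x E E⁻ → Removesₑ x (A ⇒ E) (A ⇒ E⁻)

data Removes {n} : Fin n → Nf n → Nf n → Set where
  ∀̇_  : ∀ {x A A⁻} → Removes (suc x) A A⁻ → Removes x (∀̇ A) (∀̇ A⁻)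
  ⌊_⌋ : ∀ {x E E⁻} → Removesₑ x E E⁻ → Removes x ⌊ E ⌋ ⌊ E⁻ ⌋

removesₑ-≡Y : ∀ {x} {E E⁻ : Ne n} → Removesₑ x E E⁻ → ⌈ E ⌉ₑ ≡Y var x ⇒ ⌈ E⁻ ⌉ₑ
removesₑ-≡Y {E⁻ = E} here = refl (tt , Wf-⌈⌉ₑ E)
removesₑ-≡Y {x = x} (there {A} {E} {E⁻} r) = trans
  (⇒-cong (refl (Wf-⌈⌉ A)) (removesₑ-≡Y r))
  (axiom (Wf-⌈⌉ A , tt , Wf-⌈⌉ₑ E⁻) (tt , Wf-⌈⌉ A , Wf-⌈⌉ₑ E⁻) (⇒-swap ⌈ A ⌉ (var x) ⌈ E⁻ ⌉ₑ))

removes-≡Y : ∀ {x} {A A⁻ : Nf n} → Removes x A A⁻ → ⌈ A ⌉ ≡Y var x ⇒ ⌈ A⁻ ⌉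
removes-≡Y {x = x} (∀̇_ {A⁻ = A⁻} r) = trans (∀-cong (removes-≡Y r))
  (sym (axiom (tt , Wf-⌈⌉ A⁻) (tt , Wf-⌈⌉ A⁻) (⇒-∀ (var x) ⌈ A⁻ ⌉)))
removes-≡Y ⌊ r ⌋ = removesₑ-≡Y r

Only-removesₑ : ∀ {x y} {E E⁻ : Ne n} → Removesₑ x E E⁻ → Only s y ⌈ E ⌉ₑ → Only s y ⌈ E⁻ ⌉ₑ
Only-removesₑ here      (_ , o)  = o
Only-removesₑ (there r) (o , o′) = o , Only-removesₑ r o′

Only-removes : ∀ {x y} {A A⁻ : Nf n} → Removes x A A⁻ → Only s y ⌈ A ⌉ → Only s y ⌈ A⁻ ⌉
Only-removes (∀̇ r) o = Only-removes r o
Only-removes ⌊ r ⌋ o = Only-removesₑ r o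

-- σ is the choice φ of colors, as a sign relative to the color of the current
-- root: pos if the two colors are equal.
mutual
  data Coh {n} (m : ℕ) : Nf (m + n) → Set where
    ∀̇_  : ∀ {A} → Coh (suc m) A → Coh m (∀̇ A)
    ⌊_⌋ : ∀ {E} {σ : Fin m → Sign} → Cohₑ σ E → Coh m ⌊ E ⌋

  data Cohₑ {m n} (σ : Fin m → Sign) : Ne (m + n) → Set where
    var : ∀ {x} → (∀ z → Only (σ z) (z ↑ˡ n) (var x)) → Cohₑ σ (var x)
    _⇒_ : ∀ {A E} → CohArg {n = n} σ A → Cohₑ {n = n} σ E → Cohₑ σ (A ⇒ E)

  -- An argument reverses signs and an argument of an argument restores them, whence
  -- `opposite (σ y)` for whole types and `σ y` in `ArgsOnly`. The two clause forms exempt the one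
  -- wrong occurrence: the head, or the deleted argument.
  data CohArg {m n} (σ : Fin m → Sign) (A : Nf (m + n)) : Set where
    neutral : Coh 0 A → (∀ z → Only (opposite (σ z)) (z ↑ˡ n) ⌈ A ⌉) → CohArg σ A
    clause⁺ : ∀ z → σ z ≡ pos → Coh 0 A → HeadIs (z ↑ˡ n) A →
              (∀ y → ArgsOnly (σ y) (y ↑ˡ n) A) → CohArg σ A
    clause⁻ : ∀ {A⁻} z → σ z ≡ neg → Removes (z ↑ˡ n) A A⁻ → Coh 0 A⁻ →
              (∀ y → Only (opposite (σ y)) (y ↑ˡ n) ⌈ A⁻ ⌉) → CohArg σ A

record Reduced (m : ℕ) {n} (A : Nf (m + n)) : Set where
  field
    args     : List (Ty n)
    head     : Ty n
    args-ok  : All Λpμν args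
    head-ok  : Λpμν head
    equiv    : ∀^ m ⌈ A ⌉ ≡Y args ⇒* head
    onlyArgs : ∀ {s x} → ArgsOnly s (m ↑ʳ x) A → All (Only s x) args
    onlyHead : ∀ {s x} → Only s (m ↑ʳ x) ⌈ A ⌉ → Only s x head
    headVar  : ∀ {x} → HeadIs (m ↑ʳ x) A → head ≡ var x

  Λpμν-⇒*-head : Λpμν (args ⇒* head)
  Λpμν-⇒*-head = Λpμν-⇒* args-ok head-ok

  only : ∀ {s x} → Only s (m ↑ʳ x) ⌈ A ⌉ → Only s x (args ⇒* head)
  only o = Only-⇒* (onlyArgs (Only⇒ArgsOnly A o)) (onlyHead o)

-- The input of `eliminate`: the body of a root with its arguments reduced and sorted. The `bound`
-- fields are the sign conditions on the block; the `only` fields transport signs of arbitrary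
-- variables, for use at enclosing roots.
record Split {m n} (σ : Fin m → Sign) (E : Ne (m + n)) : Set where
  field
    hyps      : List (Hyp σ (m + n))
    args      : List (Ty (m + n))
    hyps-ok   : All (HypΛpμν σ) hyps
    args-ok   : All Λpμν args
    equiv     : ⌈ E ⌉ₑ ≡Y map (⟦ σ ⟧ (_↑ˡ n)) hyps ⇒* (args ⇒* var (headₑ E))
    boundHyps : ∀ z → All (HypOnly σ (σ z) (z ↑ˡ n)) hyps
    boundArgs : ∀ z → All (Only (opposite (σ z)) (z ↑ˡ n)) args
    boundHead : ∀ z → Only (σ z) (z ↑ˡ n) (var (headₑ E))
    onlyHyps  : ∀ {s x} → ArgsOnlyₑ (opposite s) x E → All (HypOnly σ s x) hyps
    onlyArgs  : ∀ {s x} → ArgsOnlyₑ (opposite s) x E → All (Only (opposite s) x) args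

  hyps-wf : All Wf (map (⟦ σ ⟧ (_↑ˡ n)) hyps)
  hyps-wf = map⁺ (All.map (λ {(z , p)} → proj₁ ∘ Λpμν-hyp (σ z)) hyps-ok)

  args-wf : All Wf args
  args-wf = All.map proj₁ args-ok

module _ {m n} {σ : Fin m → Sign} {A : Nf (m + n)} {E : Ne (m + n)} where

  add-arg : (B : Ty (m + n)) → Λpμν B → ⌈ A ⌉ ≡Y B →
            (∀ z → Only (opposite (σ z)) (z ↑ˡ n) B) →
            (∀ {s x} → Only (opposite s) x ⌈ A ⌉ → Only (opposite s) x B) →
            Split {n = n} σ E → Split σ (A ⇒ E)
  add-arg B vB A≡B bound only S = record
    { hyps = hyps ; args = B ∷ args ; hyps-ok = hyps-ok ; args-ok = vB ∷ args-ok
    ; equiv = trans (⇒-cong A≡B equiv)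
        (⇒-⇒*-swap B _ _ (proj₁ vB) hyps-wf (Wf-⇒* args-wf tt))
    ; boundHyps = boundHyps ; boundArgs = λ z → bound z ∷ boundArgs z ; boundHead = boundHead
    ; onlyHyps = λ (_ , o) → onlyHyps o ; onlyArgs = λ (o , o′) → only o ∷ onlyArgs o′ }
    where open Split S

  add-hyp : (H : Hyp σ (m + n)) → HypΛpμν σ H → ⌈ A ⌉ ≡Y ⟦ σ ⟧ (_↑ˡ n) H →
            (∀ z → HypOnly σ (σ z) (z ↑ˡ n) H) →
            (∀ {s x} → Only (opposite s) x ⌈ A ⌉ → HypOnly σ s x H) →
            Split {n = n} σ E → Split σ (A ⇒ E)
  add-hyp H vH A≡H bound only S = record
    { hyps = H ∷ hyps ; args = args ; hyps-ok = vH ∷ hyps-ok ; args-ok = args-ok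
    ; equiv = ⇒-cong A≡H equiv
    ; boundHyps = λ z → bound z ∷ boundHyps z ; boundArgs = boundArgs ; boundHead = boundHead
    ; onlyHyps = λ (o , o′) → only o ∷ onlyHyps o′ ; onlyArgs = λ (_ , o) → onlyArgs o }
    where open Split S

  -- The reduced argument is literally a clause of Y⁺, since by `headVar` its head is unaffected by
  -- the elimination of the inner quantifiers.
  add-clause⁺ : ∀ z → σ z ≡ pos → Reduced 0 A → HeadIs (z ↑ˡ n) A →
                (∀ y → ArgsOnly (σ y) (y ↑ˡ n) A) → Split {n = n} σ E → Split σ (A ⇒ E)
  add-clause⁺ z σz≡ R h bound = add-hyp
    (z , as-payload)
    (payload-ok σz≡)
    (≡.subst (⌈ A ⌉ ≡Y_) (payload-eq σz≡) R.equiv)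
    (λ y → payload-only σz≡ (R.onlyArgs (bound y)))
    (λ {s} o → payload-only σz≡ (R.onlyArgs
      (≡.subst (λ e → ArgsOnly e _ A) (opposite-involutive s) (Only⇒ArgsOnly A o))))
    where
    module R = Reduced R
    -- `σ z` equals `pos` only propositionally, so the arguments are transported. The facts below
    -- generalize `σ z` to `τ` in order to match on the equation.
    as-payload : Payload (σ z) (m + n)
    as-payload = ≡.subst (λ τ → Payload τ (m + n)) (≡.sym σz≡) R.args
    payload-ok : ∀ {τ} (eq : τ ≡ pos) →
      PayloadΛpμν τ (≡.subst (λ τ → Payload τ (m + n)) (≡.sym eq) R.args)
    payload-ok refl = R.args-ok
    payload-eq : ∀ {τ} (eq : τ ≡ pos) → R.args ⇒* R.head ≡
      hyp τ (z ↑ˡ n) (≡.subst (λ τ → Payload τ (m + n)) (≡.sym eq) R.args)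
    payload-eq refl = cong (R.args ⇒*_) (R.headVar h)
    payload-only : ∀ {τ s x} (eq : τ ≡ pos) → All (Only s x) R.args →
      PayloadOnly s x τ (≡.subst (λ τ → Payload τ (m + n)) (≡.sym eq) R.args)
    payload-only refl os = os

  add-clause⁻ : ∀ {A⁻} z → σ z ≡ neg → Removes (z ↑ˡ n) A A⁻ → Reduced 0 A⁻ →
                (∀ y → Only (opposite (σ y)) (y ↑ˡ n) ⌈ A⁻ ⌉) →
                Split {n = n} σ E → Split σ (A ⇒ E)
  add-clause⁻ z σz≡ r R bound = add-hyp
    (z , ≡.subst (λ τ → Payload τ (m + n)) (≡.sym σz≡) B)
    (payload-ok σz≡)
    (payload-eq σz≡)
    (λ y → payload-only σz≡ (R.only (bound y)))
    (λ o → payload-only σz≡ (R.only (Only-removes r o)))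
    where
    module R = Reduced R
    B = R.args ⇒* R.head
    payload-ok : ∀ {τ} (eq : τ ≡ neg) →
      PayloadΛpμν τ (≡.subst (λ τ → Payload τ (m + n)) (≡.sym eq) B)
    payload-ok refl = R.Λpμν-⇒*-head
    payload-eq : ∀ {τ} (eq : τ ≡ neg) → ⌈ A ⌉ ≡Y
      hyp τ (z ↑ˡ n) (≡.subst (λ τ → Payload τ (m + n)) (≡.sym eq) B)
    payload-eq refl = trans (removes-≡Y r) (⇒-cong (refl tt) R.equiv)
    payload-only : ∀ {τ s x} (eq : τ ≡ neg) → Only (opposite s) x B →
      PayloadOnly s x τ (≡.subst (λ τ → Payload τ (m + n)) (≡.sym eq) B)
    payload-only refl o = o

mutual
  reduce : ∀ {m n} {A : Nf (m + n)} → Coh {n} m A → Reduced m {n} A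
  -- `∀^ (suc m) ⌈ A ⌉` unfolds to `∀^ m (∀̇ ⌈ A ⌉)`, so all fields carry over unchanged.
  reduce {m} (∀̇ c) = record
    { Reduced (reduce c) }
  reduce {m} {n} (⌊_⌋ {E} {σ} c) = record
    { args = R.args ; head = R.head ; args-ok = R.args-ok ; head-ok = R.head-ok
    ; equiv = trans (∀^-cong m S.equiv) R.equiv
    ; onlyArgs = λ {s} o → only-args s o
    ; onlyHead = λ o → let os = Only⇒ArgsOnlyₑ E o in
        R.onlyHead (S.onlyHyps os) (Only⇒headₑ E o)
    ; headVar = λ eq → R.headVar (cong var eq) }
    where
    module S = Split (split c)
    eliminated : Eliminated σ S.hyps S.args (var (headₑ E))
    eliminated = eliminate m σ S.hyps S.args (var (headₑ E)) S.hyps-ok S.args-ok (tt , tt)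
      S.boundHyps S.boundArgs S.boundHead
    module R = Eliminated eliminated
    only-args : ∀ s {x} → ArgsOnlyₑ s (m ↑ʳ x) E → All (Only s x) R.args
    -- `Eliminated.onlyArgs` delivers a sign of the form `opposite s`; matching on the sign makes
    -- this compute.
    only-args pos os = R.onlyArgs {neg} (S.onlyHyps os) (S.onlyArgs {neg} os)
    only-args neg os = R.onlyArgs {pos} (S.onlyHyps os) (S.onlyArgs {pos} os)

  split : ∀ {m n} {σ : Fin m → Sign} {E : Ne (m + n)} → Cohₑ {n = n} σ E → Split {n = n} σ E
  split (var o) = record
    { hyps = [] ; args = [] ; hyps-ok = [] ; args-ok = [] ; equiv = refl tt
    ; boundHyps = λ _ → [] ; boundArgs = λ _ → [] ; boundHead = o
    ; onlyHyps = λ _ → [] ; onlyArgs = λ _ → [] }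
  split (neutral c o ⇒ cs) = let module R = Reduced (reduce c) in
    add-arg (R.args ⇒* R.head) R.Λpμν-⇒*-head R.equiv (λ z → R.only (o z)) R.only (split cs)
  split (clause⁺ z eq c h o ⇒ cs) = add-clause⁺ z eq (reduce c) h o (split cs)
  split (clause⁻ z eq r c o ⇒ cs) = add-clause⁻ z eq r (reduce c) o (split cs)

-- From trees to normal forms

Only-flip : ∀ {x} (A : Ty n) → Only s x A → Only (opposite (opposite s)) x A
Only-flip {s = s} A = ≡.subst (λ e → Only e _ A) (≡.sym (opposite-involutive s))

ArgsOnlyₑ⇒Only : ∀ {x} (E : Ne n) → ArgsOnlyₑ s x E → Only (opposite s) x (var (headₑ E)) →
                 Only (opposite s) x ⌈ E ⌉ₑ
ArgsOnlyₑ⇒Only (var y) _        o = o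
ArgsOnlyₑ⇒Only (A ⇒ E) (o′ , p) o = Only-flip ⌈ A ⌉ o′ , ArgsOnlyₑ⇒Only E p o

removesₑ-head : ∀ {x} {E E⁻ : Ne n} → Removesₑ x E E⁻ → headₑ E ≡ headₑ E⁻
removesₑ-head here      = refl
removesₑ-head (there r) = removesₑ-head r

Cohₑ-removes : ∀ {m n x} {σ : Fin m → Sign} {E E⁻ : Ne (m + n)} → Removesₑ x E E⁻ →
               Cohₑ {n = n} σ E → Cohₑ {n = n} σ E⁻
Cohₑ-removes here      (_ ⇒ cs) = cs
Cohₑ-removes (there r) (c ⇒ cs) = c ⇒ Cohₑ-removes r cs

-- Coherence constrains each argument separately, so it survives the deletion of one.
Coh-removes : ∀ {m n x} {A A⁻ : Nf (m + n)} → Removes x A A⁻ → Coh {n} m A → Coh {n} m A⁻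
Coh-removes (∀̇ r) (∀̇ c) = ∀̇ Coh-removes r c
Coh-removes ⌊ r ⌋ ⌊ c ⌋ = ⌊ Cohₑ-removes r c ⌋

-- A form of coherence that restricts to subtrees. For equal variables `disjoint` comes from the
-- isolation of modular nodes, for distinct ones from `CoherentVars`.
record Separating {t : Tree n} (φ : BVar t → Color) : Set where
  field
    not-head : ∀ {X α} → α labelled X ^ other (φ X) → α ≢ h X
    near     : ∀ {X α} → α labelled X ^ other (φ X) → d α (r X) ≤ 2
    disjoint : ∀ {X Y α β} → Parallel α β →
               α labelled X ^ other (φ X) → ¬ (β labelled Y ^ other (φ Y))

separating : ((φ , _) : Coherent t) → Separating φ
separating (φ , elim , coh) = record
  { not-head = λ l → Modular.not-head (elim _ _ l)
  ; near     = λ l → Modular.distance₂ (elim _ _ l)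
  ; disjoint = λ {X} {Y} {α} {β} α∥β lα lβ → coh X Y
      (λ { refl → Modular.isolated (elim _ _ lα) β α∥β lβ })
      α β α∥β (elim _ _ lα) (elim _ _ lβ) }

module _ {hd : Tree (m + n)} {ts : List (Tree (m + n))} (i : Fin (suc (length ts))) where

  private
    u = lookup (hd ∷ ts) i

    down : Node u → Node {n} (node m hd ts)
    down = child i

  down-injective : ∀ {α β} → down α ≡ down β → α ≡ β
  down-injective refl = refl

  d-down : ∀ α β → d (down α) (down β) ≡ d α β
  d-down α β with i ≟ i
  ... | yes refl = refl
  ... | no  i≢i  = contradiction refl i≢i

  Parallel-down : ∀ {α β} → Parallel α β → Parallel (down α) (down β)
  Parallel-down (α≢β , γ , γ⋖α , γ⋖β) = α≢β ∘ down-injective , down γ , there γ⋖α , there γ⋖β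

  Separating-down : {φ : BVar {n} (node m hd ts) → Color} → Separating φ → Separating (φ ∘ there i)
  Separating-down S = record
    { not-head = λ l eq → S.not-head (there l) (cong down eq)
    ; near     = λ {X} {α} l → ≡.subst (_≤ 2) (d-down α (r X)) (S.near (there l))
    ; disjoint = λ α∥β lα lβ → S.disjoint (Parallel-down α∥β) (there lα) (there lβ) }
    where module S = Separating S

All-lookup⁺ : {A : Set} {P : A → Set} (xs : List A) → (∀ i → P (lookup xs i)) → All P xs
All-lookup⁺ {P = P} xs p = ≡.subst (All P) (tabulate-lookup xs) (tabulate⁺ p)

AllPairs-lookup⁺ : {A : Set} {R : A → A → Set} (xs : List A) →
                   (∀ {i j} → i ≢ j → R (lookup xs i) (lookup xs j)) → AllPairs R xs
AllPairs-lookup⁺ {R = R} xs p =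
  ≡.subst (AllPairs R) (tabulate-lookup xs) (AllPairs.tabulate⁺ {R = R} p)

-- The color of the occurrences of the sign opposite to s in a tree of color c.
wrongColor : Sign → Color → Color
wrongColor pos c = other c
wrongColor neg c = c

other-involutive : ∀ c → other (other c) ≡ c
other-involutive blue = refl
other-involutive red  = refl

wrong-other : ∀ s c → wrongColor (opposite s) (other c) ≡ wrongColor s c
wrong-other pos c = refl
wrong-other neg c = other-involutive c

sign : Color → Color → Sign
sign blue blue = pos
sign blue red  = neg
sign red  blue = neg
sign red  red  = pos

-- Occurrences of the wrong sign are thus exactly those in the color that eliminability requires to
-- be modular.
wrong-sign : ∀ c c′ → wrongColor (sign c c′) c ≡ other c′
wrong-sign blue blue = refl
wrong-sign blue red  = refl
wrong-sign red  blue = refl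
wrong-sign red  red  = refl

Absent : Fin n → Color → Tree n → Set
Absent x c t = ∀ (α : Node t) → ¬ IsFree α x c

headTree-terminal : ∀ c (E : Ne n) → headTree c E ≡ terminal (headₑ E) c
headTree-terminal c (var x) = refl
headTree-terminal c (A ⇒ E) = headTree-terminal c E

mutual
  -- Colors alternate along arrows as signs do, so a variable without terminal nodes of the wrong
  -- color has only occurrences of the right sign.
  absent⇒only : ∀ m c (A : Nf (m + n)) s {x} → Absent x (wrongColor s c) (treeNf m c A) →
                Only s (m ↑ʳ x) ⌈ A ⌉
  absent⇒only m c (∀̇ A) s a = absent⇒only (suc m) c A s a
  absent⇒only m c ⌊ E ⌋ s a = absent⇒onlyₑ m c E s (λ α f → a (child zero α) (child f))
    (All-lookup⁺ _ λ i α f → a (child (suc i) α) (child f))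

  absent⇒onlyₑ : ∀ m c (E : Ne (m + n)) s {x} → Absent x (wrongColor s c) (headTree c E) →
                 All (Absent x (wrongColor s c)) (argTrees m c E) → Only s x ⌈ E ⌉ₑ
  absent⇒onlyₑ m c (var y) pos a _        _    = refl
  absent⇒onlyₑ m c (var y) neg a _        refl = contradiction terminal (a root)
  absent⇒onlyₑ m c (A ⇒ E) s   a (a′ ∷ as) = absent⇒onlyArg m c A s a′ , absent⇒onlyₑ m c E s a as

  absent⇒onlyArg : ∀ m c (A : Nf (m + n)) s {x} → Absent x (wrongColor s c) (argTree m c A) →
                   Only (opposite s) x ⌈ A ⌉
  absent⇒onlyArg m c ⌊ var y ⌋ neg a _ = refl
  -- Whether drawn as a terminal node or in the expanded form, the variable has the wrong color
  -- here.
  absent⇒onlyArg m c ⌊ var y ⌋ pos a refl with splitAt m y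
  ... | inj₁ _ = contradiction (child terminal) (a (child zero root))
  ... | inj₂ _ = contradiction terminal (a root)
  absent⇒onlyArg m c A@(⌊ _ ⇒ _ ⌋) s {x} a = absent⇒only 0 (other c) A (opposite s)
    (≡.subst (λ e → Absent x e (treeNf 0 (other c) A)) (≡.sym (wrong-other s c)) a)
  absent⇒onlyArg m c A@(∀̇ _) s {x} a = absent⇒only 0 (other c) A (opposite s)
    (≡.subst (λ e → Absent x e (treeNf 0 (other c) A)) (≡.sym (wrong-other s c)) a)

free-not-root : ∀ m c (A : Nf (m + n)) {α x e} → IsFree {t = treeNf m c A} α x e → ¬ (depth α ≤ 0)
free-not-root m c (∀̇ A) f         p = free-not-root (suc m) c A f p
free-not-root m c ⌊ E ⌋ (child f) ()

-- Classification of the arguments of a root.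

is-bound? : (σ : Fin m → Sign) (ι : Fin m → Fin n) → ∀ w e → Dec (∃[ z ] (w ≡ ι z × σ z ≡ e))
is-bound? σ ι w e = any? λ z → (w ≟ ι z) ×-dec (σ z Sign.≟ e)

module _ {N m} (σ : Fin m → Sign) (ι : Fin m → Fin N) (c : Color) where

  -- Wrong occurrences in the tree of an argument of a root of color c, for
  -- variables which are bound at that root with the relative signs σ.
  WrongAt : ∀ k {t : Tree (k + N)} → Node t → Set
  WrongAt k α = ∃[ z ] IsFree α (k ↑ʳ ι z) (wrongColor (σ z) c)

  WrongRoot : ∀ k → Tree (k + N) → Set
  WrongRoot k t = WrongAt k {t} root

  OnlyRootWrong : ∀ k → Tree (k + N) → Set
  OnlyRootWrong k t = ∀ {α : Node t} → WrongAt k α → depth α ≤ 0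

  data Classified k (A : Nf (k + N)) : Set where
    neutral : (∀ y → Only (opposite (σ y)) (k ↑ʳ ι y) ⌈ A ⌉) → Classified k A
    clause⁺ : ∀ z → σ z ≡ pos → HeadIs (k ↑ʳ ι z) A →
              (∀ y → ArgsOnly (σ y) (k ↑ʳ ι y) A) → Classified k A
    clause⁻ : ∀ {A⁻} z → σ z ≡ neg → Removes (k ↑ʳ ι z) A A⁻ →
              (∀ y → Only (opposite (σ y)) (k ↑ʳ ι y) ⌈ A⁻ ⌉) → Classified k A

  ∀-classified : ∀ {k A} → Classified (suc k) A → Classified k (∀̇ A)
  ∀-classified (neutral o)        = neutral o
  ∀-classified (clause⁺ z eq h o) = clause⁺ z eq h o
  ∀-classified (clause⁻ z eq r o) = clause⁻ z eq (∀̇ r) o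

  data ArgStatus k (A : Nf (k + N)) : Set where
    right : (∀ y → Only (σ y) (k ↑ʳ ι y) ⌈ A ⌉) → ArgStatus k A
    wrong : ∀ z → A ≡ ⌊ var (k ↑ʳ ι z) ⌋ → σ z ≡ neg → WrongRoot k (argTree k (other c) A) →
            ArgStatus k A

  only-in-arg : ∀ k (A : Nf (k + N)) →
                (∀ {α} → ¬ WrongAt k {treeNf 0 (other (other c)) A} α) →
                ∀ y → Only (σ y) (k ↑ʳ ι y) ⌈ A ⌉
  only-in-arg k A a y = absent⇒only 0 c A (σ y)
    (≡.subst (λ e → Absent (k ↑ʳ ι y) (wrongColor (σ y) c) (treeNf 0 e A)) (other-involutive c)
      λ α f → a (y , f))

  -- An argument of an argument occurs positively, so a bare variable of the block is wrong there
  -- exactly if its sign is `neg`. Any other normal form is drawn with a non-terminal root, so it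
  -- contains no wrong occurrence.
  argStatus : ∀ k A → OnlyRootWrong k (argTree k (other c) A) → ArgStatus k A
  argStatus k ⌊ var w ⌋ p with is-bound? σ (λ z → k ↑ʳ ι z) w neg
  ... | yes (z , refl , eq) = wrong z refl eq (z , wrong-root)
    where
    wrong-root : IsFree {t = argTree k (other c) ⌊ var (k ↑ʳ ι z) ⌋} root
                   (k ↑ʳ ι z) (wrongColor (σ z) c)
    -- The variable is not quantified at the root of the argument, so its node is terminal; after
    -- two changes of color it has color `c` again.
    wrong-root rewrite splitAt-↑ʳ k N (ι z) | eq | other-involutive c = terminal
  ... | no  w≢ = right only
    where
    only : ∀ y → k ↑ʳ ι y ≡ w → σ y ≡ pos
    only y eq with σ y in σy≡
    ... | pos = refl
    ... | neg = contradiction (y , ≡.sym eq , σy≡) w≢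
  argStatus k A@(⌊ _ ⇒ _ ⌋) p =
    right (only-in-arg k A λ (z , f) → free-not-root 0 _ A f (p (z , f)))
  argStatus k A@(∀̇ _) p =
    right (only-in-arg k A λ (z , f) → free-not-root 0 _ A f (p (z , f)))

  all-right : ∀ k E → All (OnlyRootWrong k) (argTrees k (other c) E) →
              All (¬_ ∘ WrongRoot k) (argTrees k (other c) E) →
              ∀ y → ArgsOnlyₑ (σ y) (k ↑ʳ ι y) E
  all-right k (var w) _        _        y = tt
  all-right k (A ⇒ E) (p ∷ ps) (q ∷ qs) y with argStatus k A p
  ... | right o       = o y , all-right k E ps qs y
  ... | wrong _ _ _ w = contradiction w q

  data ArgsStatus k (E : Ne (k + N)) : Set where
    right : (∀ y → ArgsOnlyₑ (σ y) (k ↑ʳ ι y) E) → ArgsStatus k E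
    wrong : ∀ {E⁻} z → σ z ≡ neg → Removesₑ (k ↑ʳ ι z) E E⁻ →
            (∀ y → ArgsOnlyₑ (σ y) (k ↑ʳ ι y) E⁻) → ArgsStatus k E

  -- Wrong roots of two arguments would be parallel, so once one is found the rest are right.
  argsStatus : ∀ k E → All (OnlyRootWrong k) (argTrees k (other c) E) →
               AllPairs (λ t u → WrongRoot k t → ¬ WrongRoot k u) (argTrees k (other c) E) →
               ArgsStatus k E
  argsStatus k (var w) _        _        = right λ _ → tt
  argsStatus k (A ⇒ E) (p ∷ ps) (q ∷ qs) with argStatus k A p
  ... | wrong z refl eq w = wrong z eq here (all-right k E ps (All.map (λ ¬w → ¬w w) q))
  ... | right o with argsStatus k E ps qs
  ...   | right os        = right λ y → o y , os y
  ...   | wrong z eq r os = wrong z eq (there r) λ y → o y , os y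

  -- The head of an argument occurs negatively, so it is wrong exactly if it is a variable of the
  -- block with sign `pos`. It is parallel to the roots of the arguments: a wrong head leaves them
  -- all right and gives a clause of Y⁺, and otherwise a single wrong argument gives a clause of Y⁻.
  classifyₑ : ∀ k E → All (OnlyRootWrong k) (argTrees k (other c) E) →
              AllPairs (λ t u → WrongRoot k t → ¬ WrongRoot k u)
                (headTree (other c) E ∷ argTrees k (other c) E) →
              Classified k ⌊ E ⌋
  classifyₑ k E ps (q ∷ qs) with is-bound? σ (λ z → k ↑ʳ ι z) (headₑ E) pos
  ... | yes (z , h≡ , eq) =
    clause⁺ z eq h≡ (all-right k E ps (All.map (λ ¬w → ¬w (z , wrong-head)) q))
    where
    wrong-head : IsFree {t = headTree (other c) E} root (k ↑ʳ ι z) (wrongColor (σ z) c)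
    wrong-head rewrite headTree-terminal (other c) E | h≡ | eq = terminal
  ... | no h≢ with argsStatus k E ps qs
  ...   | right os        = neutral λ y → ArgsOnlyₑ⇒Only E (os y) (right-head y)
    where
    right-head : ∀ y → k ↑ʳ ι y ≡ headₑ E → opposite (σ y) ≡ pos
    right-head y eq with σ y in σy≡
    ... | neg = refl
    ... | pos = contradiction (y , ≡.sym eq , σy≡) h≢
  ...   | wrong {E⁻} z eq r os =
    clause⁻ z eq ⌊ r ⌋ λ y → ArgsOnlyₑ⇒Only E⁻ (os y) (right-head y)
    where
    right-head : ∀ y → k ↑ʳ ι y ≡ headₑ E⁻ → opposite (σ y) ≡ pos
    right-head y eq with σ y in σy≡
    ... | neg = refl
    ... | pos = contradiction (y , ≡.trans (removesₑ-head r) (≡.sym eq) , σy≡) h≢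

  -- Depth is counted from the root of the argument, one edge below the binding root; hence the
  -- bound 1 for distance 2.
  record Localized (t : Tree N) : Set where
    field
      shallow  : ∀ {α : Node t} → WrongAt 0 α → depth α ≤ 1
      disjoint : ∀ {α β : Node t} → Parallel α β → WrongAt 0 α → ¬ WrongAt 0 β

  classify : ∀ k A → Localized (treeNf k (other c) A) → Classified k A
  classify k (∀̇ A) L = ∀-classified (classify (suc k) A L)
  classify k ⌊ E ⌋ L = classifyₑ k E (All.tail only-root) pairwise
    where
    module L = Localized L
    trees = headTree (other c) E ∷ argTrees k (other c) E
    only-root : All (OnlyRootWrong k) trees
    only-root = All-lookup⁺ trees λ i (z , f) → s≤s⁻¹ (L.shallow {child i _} (z , child f))
    pairwise : AllPairs (λ t u → WrongRoot k t → ¬ WrongRoot k u) trees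
    pairwise = AllPairs-lookup⁺ trees λ {i} {j} i≢j (z , f) (y , g) →
      L.disjoint {child i root} {child j root} ((λ { refl → i≢j refl }) , root , here , here)
        (z , child f) (y , child g)

-- Coherence of the normal form.

record LocalSeparation {m n} (σ : Fin m → Sign) (c : Color) (t : Tree (m + n)) : Set where
  field
    choice     : BVar t → Color
    separates  : Separating choice
    localized  : Localized σ (_↑ˡ n) c t

mutual
  coherent : ∀ m {n} (A : Nf (m + n)) c {φ} → Separating {t = treeNf m c A} φ → Coh {n} m A
  coherent m (∀̇ A) c S = ∀̇ coherent (suc m) A c S
  coherent m {n} ⌊ E ⌋ c {φ} S = ⌊ coherentₑ {n = n} {σ} E
      -- A wrong occurrence in the head of this root would be `h (here z)` itself.
      (λ (z , f) → S.not-head {here z} (label zero z f) refl)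
      (All-lookup⁺ (argTrees m c E) λ i → record
        { choice = φ ∘ there (suc i)
        ; separates = Separating-down (suc i) S
        ; localized = record
          { shallow  = λ {α} (z , f) → s≤s⁻¹ (S.near {here z} (label (suc i) z f))
          ; disjoint = λ α∥β (z , f) (y , g) →
              S.disjoint {here z} {here y} (Parallel-down (suc i) α∥β)
                (label (suc i) z f) (label (suc i) y g) } }) ⌋
    where
    module S = Separating S
    σ : Fin m → Sign
    σ z = sign c (φ (here z))
    label : ∀ i {α : Node (lookup (headTree c E ∷ argTrees m c E) i)} z →
            IsFree α (z ↑ˡ n) (wrongColor (σ z) c) →
            _labelled_^_ {t = treeNf m c ⌊ E ⌋} (child i α) (here z) (other (φ (here z)))
    label i {α} z f = here (≡.subst (IsFree α (z ↑ˡ n)) (wrong-sign c (φ (here z))) f)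

  coherentₑ : ∀ {m n} {σ : Fin m → Sign} {c} (E : Ne (m + n)) →
              ¬ (∃[ z ] IsFree {t = headTree c E} root (z ↑ˡ n) (wrongColor (σ z) c)) →
              All (LocalSeparation σ c) (argTrees m c E) → Cohₑ {n = n} σ E
  coherentₑ {m} {n} {σ} {c} (var x) hd _ = var only
    where
    only : ∀ z → z ↑ˡ n ≡ x → σ z ≡ pos
    only z refl with σ z in eq
    ... | pos = refl
    ... | neg = contradiction
      (z , ≡.subst (λ e → IsFree {t = terminal x c} root x (wrongColor e c)) (≡.sym eq) terminal) hd
  coherentₑ (A ⇒ E) hd (l ∷ ls) = coherentArg A l ⇒ coherentₑ E hd ls

  coherentArg : ∀ {m n} {σ : Fin m → Sign} {c} (A : Nf (m + n)) →
                LocalSeparation {n = n} σ c (argTree m c A) → CohArg {n = n} σ A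
  coherentArg {m} {n} {σ} ⌊ var w ⌋ l with is-bound? σ (_↑ˡ n) w pos
  -- A bare variable of sign `pos` is a clause of Y⁺ with no arguments, contributing the summand `𝟙`
  -- to the solution.
  ... | yes (z , refl , eq) = clause⁺ z eq (⌊_⌋ {σ = λ ()} (var λ ())) refl λ _ → tt
  ... | no  w≢              = neutral (⌊_⌋ {σ = λ ()} (var λ ())) only
    where
    only : ∀ y → y ↑ˡ n ≡ w → opposite (σ y) ≡ pos
    only y eq with σ y in σy≡
    ... | neg = refl
    ... | pos = contradiction (y , ≡.sym eq , σy≡) w≢
  coherentArg {n = n} {σ} {c} A@(⌊ _ ⇒ _ ⌋) l =
    combine (coherent 0 A (other c) (separates l)) (classify σ (_↑ˡ n) c 0 A (localized l))
    where open LocalSeparation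
  coherentArg {n = n} {σ} {c} A@(∀̇ _) l =
    combine (coherent 0 A (other c) (separates l)) (classify σ (_↑ˡ n) c 0 A (localized l))
    where open LocalSeparation

  combine : ∀ {m n} {σ : Fin m → Sign} {c} {A : Nf (m + n)} → Coh 0 A →
            Classified σ (_↑ˡ n) c 0 A → CohArg {n = n} σ A
  combine C (neutral o)        = neutral C o
  combine C (clause⁺ z eq h o) = clause⁺ z eq C h o
  combine C (clause⁻ z eq r o) = clause⁻ z eq r (Coh-removes r C) o

corollary5p1 : ∀ {n : ℕ} {A : Ty n} (A∈Λ2 : Λ2 A) →
    Coherent (tree A∈Λ2) →
    ∃[ A′ ] (Λpμν A′ × A ≡Y A′)
corollary5p1 A∈Λ2 C = _ , R.Λpμν-⇒*-head , trans (nf-≡Y A∈Λ2) R.equiv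
  where module R = Reduced (reduce (coherent 0 (nf A∈Λ2) blue (separating C)))
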